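{- Let $\alpha=(\alpha_1,\ldots,\alpha_n)$ and $\beta=(\beta_1,\ldots,\beta_m)$ be compositions of $N$, and let $(\alpha,\beta)=(\alpha_1,\ldots,\alpha_n,\beta_1,\ldots,\beta_m)$ denote their concatenation. Then for every $\pi\in S_3$, \[ |S_{\alpha\beta}(\pi)|=|S_{\beta\alpha}(\pi)|=K_{(N,N)(\alpha,\beta)} . \] In particular this number is independent of the choice of $\pi\in S_3$ and of the order of the entries of $\alpha$ and of $\beta$. Moreover, if $\alpha$ and $\beta$ are partitions, it is Schur-concave in $\alpha$ and in $\beta$: if $\alpha,\alpha'$ are partitions of $N$ with $\alpha$ dominating $\alpha'$, then $|S_{\alpha\beta}(\pi)|\le |S_{\alpha'\beta}(\pi)|$, and similarly in $\beta$.
   Context: A composition of $N$ is a finite sequence $\alpha=(\alpha_1,\ldots,\alpha_n)$ of nonnegative integers summing to $N$; $[\alpha]$ denotes the multiset $\{1^{\alpha_1},\ldots,n^{\alpha_n}\}$. For compositions $\alpha$ (with $n$ parts) and $\beta$ (with $m$ parts) of $N$, a generalized permutation of $\alpha\to\beta$ is a two-rowed array whose top row is $1^{\alpha_1}2^{\alpha_2}\cdots n^{\alpha_n}$ and whose bottom row is $\tau_{11}\cdots\tau_{1\alpha_1}\tau_{21}\cdots\tau_{2\alpha_2}\cdots\tau_{n1}\cdots\tau_{n\alpha_n}$ with $\tau_{i1}\le\cdots\le\tau_{i\alpha_i}$ for each $i$ (the $i$-th block) and with multiset of bottom entries equal to $[\beta]$; $S_{\alpha\beta}$ is the set of these. For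 $\pi\in S_3$, $\tau\in S_{\alpha\beta}$ avoids $\pi$ if there are no indices $1\le i_1<i_2<i_3\le n$ (distinct blocks) and $j_1,j_2,j_3$ such that $\tau_{i_1j_1}\tau_{i_2j_2}\tau_{i_3j_3}$ is order isomorphic to $\pi$, i.e. $\tau_{i_sj_s}<\tau_{i_tj_t}$ iff $\pi_s<\pi_t$. $S_{\alpha\beta}(\pi)$ is the set of $\tau\in S_{\alpha\beta}$ avoiding $\pi$. For a partition $\lambda$ and a composition $\mu$, the Kostka number $K_{\lambda\mu}$ is the number of semistandard Young tableaux of shape $\lambda$ and type $\mu$ (entry $i$ occurring $\mu_i$ times); $(N,N)$ is the two-row shape with both rows of length $N$. For partitions $\mu,\nu$ of $N$, $\mu$ dominates $\nu$ if $\mu_1+\cdots+\mu_i\ge\nu_1+\cdots+\nu_i$ for all $i$. -}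

module Defs where

open import Data.Nat.ListAction using (sum)
open import Data.Nat using (ℕ; zero; suc; _≤_; _<_; _≥_)
open import Data.Fin as F using (Fin)
open import Data.Fin.Permutation using (Permutation′; _⟨$⟩ʳ_)
open import Data.List using (List; []; _∷_; _++_; replicate; concat; map; take; length; lookup)
open import Data.List.Relation.Unary.All using (All)
open import Data.List.Relation.Unary.Linked using (Linked)
open import Data.List.Membership.Propositional using (_∈_)
open import Data.List.Relation.Binary.Permutation.Propositional using (_↭_)
open import Data.Vec using (Vec; []; _∷_) renaming (lookup to vlookup)
open import Data.Product using (Σ; ∃; _×_)
open import Data.Unit using (⊤)
open import Data.Empty using (⊥)
open import Function.Bundles using (_⇔_)
open import Relation.Binary.PropositionalEquality using (_≡_)
open import Relation.Nullary using (¬_)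

record Enumerates {A : Set} (P : A → Set) (k : ℕ) : Set where
  field
    elem      : Fin k → A
    sound     : ∀ i → P (elem i)
    complete  : ∀ a → P a → ∃ λ i → elem i ≡ a
    injective : ∀ i j → elem i ≡ elem j → i ≡ j

-- Compositions are lists of naturals; a composition of N is one with sum N.
-- The multiset [α] = {1^α₁, 2^α₂, …, n^αₙ} as a list 1^α₁ 2^α₂ ⋯ n^αₙ.
msetFrom : ℕ → List ℕ → List ℕ
msetFrom k []       = []
msetFrom k (a ∷ as) = replicate a k ++ msetFrom (suc k) as

mset : List ℕ → List ℕ
mset = msetFrom 1

WeaklyIncr : List ℕ → Set
WeaklyIncr = Linked _≤_

-- Generalized permutations α → β.  τ is the bottom row, cut into its
-- blocks: τ = (block 1, …, block n), block i having α_i entries,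
-- each block weakly increasing, all bottom entries forming [β].
GenPerm : List ℕ → List ℕ → List (List ℕ) → Set
GenPerm α β τ = (map length τ ≡ α) × All WeaklyIncr τ × (concat τ ↭ mset β)

OrderIso : Vec ℕ 3 → Permutation′ 3 → Set
OrderIso w π = ∀ s t → (vlookup w s < vlookup w t) ⇔ ((π ⟨$⟩ʳ s) F.< (π ⟨$⟩ʳ t))

Contains : Permutation′ 3 → List (List ℕ) → Set
Contains π τ =
  Σ (Fin (length τ)) λ i₁ → Σ (Fin (length τ)) λ i₂ → Σ (Fin (length τ)) λ i₃ →
  (i₁ F.< i₂) × (i₂ F.< i₃) ×
  Σ ℕ λ x → Σ ℕ λ y → Σ ℕ λ z →
  (x ∈ lookup τ i₁) × (y ∈ lookup τ i₂) × (z ∈ lookup τ i₃) ×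
  OrderIso (x ∷ y ∷ z ∷ []) π

Avoids : Permutation′ 3 → List (List ℕ) → Set
Avoids π τ = ¬ Contains π τ

SAvoid : List ℕ → List ℕ → Permutation′ 3 → List (List ℕ) → Set
SAvoid α β π τ = GenPerm α β τ × Avoids π τ

-- Semistandard Young tableaux, given as the list of rows.
-- Below r r' : row r' lies directly under row r with strictly increasing
-- columns (r' no longer than r).
Below : List ℕ → List ℕ → Set
Below r        []       = ⊤
Below []       (b ∷ bs) = ⊥
Below (a ∷ as) (b ∷ bs) = (a < b) × Below as bs

SSYT : List ℕ → List ℕ → List (List ℕ) → Set
SSYT λ' μ T = (map length T ≡ λ') × All WeaklyIncr T × Linked Below T × (concat T ↭ mset μ)

Kostka : List ℕ → List ℕ → ℕ → Set
Kostka λ' μ = Enumerates (SSYT λ' μ)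

twoRow : ℕ → List ℕ
twoRow N = N ∷ N ∷ []

IsPartition : List ℕ → Set
IsPartition μ = Linked _≥_ μ × All (λ a → 0 < a) μ

Dominates : List ℕ → List ℕ → Set
Dominates μ ν = ∀ i → sum (take i μ) ≥ sum (take i ν)

{-# OPTIONS --safe #-}

-- Every quantity in the theorem equals walks (α ++ β) 0, the number of walks on ℕ
-- from 0 to 0 whose i-th step goes from h to h + μᵢ − 2b with 0 ≤ b ≤ min(h, μᵢ),
-- where μ = (α, β).  A two-row tableau is such a walk: b counts the entries i in
-- its second row and h is the overhang of the first row.  The fusion rule
-- w(a+1, b+1, μ) = w(a, b, μ) + w(a+b+2, μ) for this number w implies its symmetry
-- and its monotonicity when two parts are made more equal.
--
-- Suppose τ avoids 321 (or 312).  Once a block with maximum c has been read, the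
-- remaining values below c must appear in weakly increasing (decreasing) order, so
-- only their number R matters.  Reading the next block value by value, either one
-- more copy of c is taken, or all copies of c that are left join the R pending
-- values; this recursion is again the fusion rule.  The other four patterns follow
-- by reversing the order of the blocks and complementing the values.

module Submission where

open import Defs
open import Data.Nat using (ℕ; zero; suc; _+_; _∸_; _≤_; _<_; _≥_; z≤n; s≤s; _≤?_; _<?_; _≥?_; _≟_)
open import Data.Nat.Properties
open import Data.Nat.ListAction using (sum)
open import Data.Nat.ListAction.Properties using (sum-++; sum-↭)
open import Data.Nat.Solver using (module +-*-Solver)
open import Data.Fin as F using (Fin; zero; suc; splitAt; _↑ˡ_; _↑ʳ_)
open import Data.Fin.Patterns using (0F; 1F; 2F)
import Data.Fin.Properties as F
open import Data.Fin.Permutation using (Permutation′; _⟨$⟩ʳ_; _⟨$⟩ˡ_; inverseˡ; inverseʳ)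
open import Data.List as List using (List; []; _∷_; _++_; take; drop; length; replicate; map; concat; filter; reverse; lookup)
open import Data.List.Properties using (take-[]; length-++; length-replicate; length-map; length-reverse; ++-assoc; ++-identityʳ; ∷-injectiveˡ; ∷-injectiveʳ; filter-all; filter-none; filter-++; unfold-reverse; reverse-map; reverse-involutive; map-++; map-∘; map-cong; map-replicate; map-id-local)
open import Data.List.Relation.Unary.Any using (here; there)
open import Data.List.Membership.Propositional using (_∈_; _∉_)
open import Data.List.Membership.Propositional.Properties using (∈-++⁺ˡ; ∈-++⁺ʳ; ∈-++⁻; ∈-concat⁺′; ∈-concat⁻′; ∈-∃++; ∈-filter⁻; ∈-map⁺)
open import Data.List.Relation.Unary.All as All using (All; []; _∷_)
import Data.List.Relation.Unary.All.Properties as All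
open import Data.List.Relation.Unary.AllPairs as AllPairs using (AllPairs; []; _∷_)
import Data.List.Relation.Unary.AllPairs.Properties as AllPairs
open import Data.List.Relation.Unary.Linked using ([]; [-]; _∷_)
open import Data.List.Relation.Unary.Linked.Properties using (Linked⇒AllPairs; AllPairs⇒Linked)
open import Data.List.Relation.Unary.Sorted.TotalOrder.Properties using (↗↭↗⇒≋)
open import Data.List.Relation.Binary.Pointwise using (Pointwise-≡⇒≡)
open import Data.List.Relation.Binary.Sublist.Propositional as Sublist using (_⊆_; []; _∷_; _∷ʳ_; from∈)
open import Data.List.Relation.Binary.Sublist.Propositional.Properties using (All-resp-⊆; reverse⁺; map⁺)
open import Data.List.Relation.Binary.Permutation.Propositional using (_↭_; refl; prep; swap; trans; ↭-sym; ↭-trans; ↭-refl; ↭-reflexive; ↭⇒↭ₛ)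
open import Data.List.Relation.Binary.Permutation.Propositional.Properties as Perm using (drop-∷; shift; ∈-resp-↭; All-resp-↭; ↭-length; ↭-reverse; filter-↭; ¬x∷xs↭[])
open import Data.Vec using ([]; _∷_) renaming (lookup to vlookup)
open import Data.Product using (_×_; _,_; proj₁; proj₂; ∃)
open import Data.Sum using (_⊎_; inj₁; inj₂; [_,_]′)
open import Data.Unit using (⊤; tt)
open import Data.Empty using (⊥-elim)
open import Function using (_∘_; id)
open import Function.Bundles using (mk⇔; Equivalence)
open import Relation.Binary.Definitions using (tri<; tri≈; tri>)
open import Relation.Binary.PropositionalEquality as ≡ using (_≡_; _≢_; refl; cong; cong₂; subst; subst₂; sym)
open import Relation.Nullary using (¬_; Dec; yes; no; contradiction)
open import Relation.Nullary.Decidable using (decidable-stable)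
open +-*-Solver using (solve; con; _:+_; _:=_)

-- Walks

-- clebschGordan m h f = Σ f (h + m − 2b) over 0 ≤ b ≤ min m h
clebschGordan : ℕ → ℕ → (ℕ → ℕ) → ℕ
clebschGordan zero    h       f = f h
clebschGordan (suc m) zero    f = f (suc m)
clebschGordan (suc m) (suc h) f = f (suc m + suc h) + clebschGordan m h f

walks : List ℕ → ℕ → ℕ
walks []      zero    = 1
walks []      (suc _) = 0
walks (m ∷ μ) h       = clebschGordan m h (walks μ)

clebschGordan-zeroʳ : ∀ m f → clebschGordan m 0 f ≡ f m
clebschGordan-zeroʳ zero    f = refl
clebschGordan-zeroʳ (suc m) f = refl

clebschGordan-cong : ∀ m h {f g} → (∀ x → f x ≡ g x) → clebschGordan m h f ≡ clebschGordan m h g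
clebschGordan-cong zero    h       e = e h
clebschGordan-cong (suc m) zero    e = e (suc m)
clebschGordan-cong (suc m) (suc h) e = cong₂ _+_ (e _) (clebschGordan-cong m h e)

clebschGordan-mono : ∀ m h {f g} → (∀ x → f x ≤ g x) → clebschGordan m h f ≤ clebschGordan m h g
clebschGordan-mono zero    h       e = e h
clebschGordan-mono (suc m) zero    e = e (suc m)
clebschGordan-mono (suc m) (suc h) e = +-mono-≤ (e _) (clebschGordan-mono m h e)

-- Write V_m for the irreducible representation of SL_2 of highest weight m. `clebschGordan m h f`
-- sums `f` over the constituents of V_h ⊗ V_m, and the rule reflects that V_(a+1) ⊗ V_(b+1) is V_a
-- ⊗ V_b plus V_(a+b+2). The induction lowers `a` and `h` together.
clebschGordan-fusion : ∀ a b h f →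
  clebschGordan (suc a) h (λ x → clebschGordan (suc b) x f)
    ≡ clebschGordan a h (λ x → clebschGordan b x f) + clebschGordan (suc a + suc b) h f
clebschGordan-fusion a b zero f
  rewrite clebschGordan-zeroʳ a (λ x → clebschGordan b x f) | +-comm (suc b) (suc a)
  = +-comm (f (suc a + suc b)) (clebschGordan b a f)
clebschGordan-fusion zero b (suc h) f
  rewrite +-comm b (suc (suc h)) | +-comm b (suc h)
  = solve 3 (λ x y z → x :+ y :+ z := y :+ (x :+ z)) refl
      (f (suc (suc (suc (h + b))))) (clebschGordan b (suc h) f) (clebschGordan (suc b) h f)
clebschGordan-fusion (suc a) b (suc h) f
  rewrite clebschGordan-fusion a b h f
        | solve 3 (λ a b h → b :+ (con 2 :+ a :+ (con 1 :+ h)) := con 1 :+ a :+ (con 1 :+ b) :+ (con 1 :+ h)) refl a b h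
  = solve 4 (λ x y z u → x :+ y :+ (z :+ u) := y :+ z :+ (x :+ u)) refl
      (f (suc (suc (a + suc b + suc h)))) (clebschGordan b (suc a + suc h) f)
      (clebschGordan a h (λ x → clebschGordan b x f)) (clebschGordan (suc a + suc b) h f)

walks-fusion : ∀ a b μ h →
  walks (suc a ∷ suc b ∷ μ) h ≡ walks (a ∷ b ∷ μ) h + walks (suc a + suc b ∷ μ) h
walks-fusion a b μ h = clebschGordan-fusion a b h (walks μ)

-- Fusion lowers both parts by one and splits off the single part `a + b + 2`, in which their order
-- no longer shows. A part 0 is a step that does nothing.
walks-swap : ∀ a b μ h → walks (a ∷ b ∷ μ) h ≡ walks (b ∷ a ∷ μ) h
walks-swap zero    b       μ h = refl
walks-swap (suc a) zero    μ h = refl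
walks-swap (suc a) (suc b) μ h
  rewrite walks-fusion a b μ h | walks-fusion b a μ h
        | walks-swap a b μ h | +-comm (suc a) (suc b) = refl

walks-↭ : ∀ {μ ν} → μ ↭ ν → ∀ h → walks μ h ≡ walks ν h
walks-↭ refl         h = refl
walks-↭ (prep m p)   h = clebschGordan-cong m h (walks-↭ p)
walks-↭ (swap {xs = μ} {ys = ν} a b p) h =
  ≡.trans (walks-swap a b μ h)
    (clebschGordan-cong b h λ x → clebschGordan-cong a x (walks-↭ p))
walks-↭ (trans p q)  h = ≡.trans (walks-↭ p h) (walks-↭ q h)

-- A step of size `m` lowers the height by at most `m`, so `f` is evaluated only at those `x` with
-- `h ≤ m + x`.
clebschGordan-vanish : ∀ m h f → (∀ x → h ≤ m + x → f x ≡ 0) → clebschGordan m h f ≡ 0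
clebschGordan-vanish zero    h       f z = z h ≤-refl
clebschGordan-vanish (suc m) zero    f z = z (suc m) z≤n
clebschGordan-vanish (suc m) (suc h) f z
  rewrite z (suc m + suc h) (≤-trans (m≤n+m (suc h) (suc m)) (m≤n+m (suc m + suc h) (suc m)))
  = clebschGordan-vanish m h f λ x h≤ → z x (s≤s h≤)

walks-vanish : ∀ μ h → sum μ < h → walks μ h ≡ 0
walks-vanish []      (suc h) _  = refl
walks-vanish (m ∷ μ) h       lt =
  clebschGordan-vanish m h (walks μ) λ x h≤ → walks-vanish μ x (+-cancelˡ-< m _ _ (<-≤-trans lt h≤))

walks-sum-zero : ∀ μ → sum μ ≡ 0 → walks μ 0 ≡ 1
walks-sum-zero []         _  = refl
walks-sum-zero (zero ∷ μ) eq = walks-sum-zero μ eq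

-- Monotonicity in the dominance order

walks-zeros-++ : ∀ μ ν h → sum μ ≡ 0 → walks (μ ++ ν) h ≡ walks ν h
walks-zeros-++ []         ν h _  = refl
walks-zeros-++ (zero ∷ μ) ν h eq = walks-zeros-++ μ ν h eq

-- Fusion splits off the same term on both sides, because the two parts have the same total, and
-- lowers `x` and `y` by one. Once `x` is 0, either the sides agree or the left one is itself the
-- fused term of the right one.
walks-spread : ∀ x y d μ h → x ≤ y → walks (y + d ∷ x ∷ μ) h ≤ walks (y ∷ x + d ∷ μ) h
walks-spread zero y zero μ h _ rewrite +-identityʳ y = ≤-refl
walks-spread zero zero (suc d) μ h _ = ≤-refl
walks-spread zero (suc y) (suc d) μ h _
  rewrite walks-fusion y d μ h = m≤n+m _ _
walks-spread (suc x) (suc y) d μ h (s≤s x≤y)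
  rewrite walks-fusion (y + d) x μ h | walks-fusion y (x + d) μ h
        | solve 3 (λ x y d → con 1 :+ (y :+ d) :+ (con 1 :+ x) := con 1 :+ (y :+ (con 1 :+ (x :+ d)))) refl x y d
  = +-monoˡ-≤ _ (walks-spread x y d μ h x≤y)

-- The surplus `d` of a leading part `y + d` goes to the first part to which `walks-spread` applies.
-- A missing part counts as 0, hence the final `d ∷ []`.
unload : ℕ → ℕ → List ℕ → List ℕ
unload y d []       = d ∷ []
unload y d (x ∷ xs) with x ≤? y
... | yes _ = x + d ∷ xs
... | no  _ = x ∷ unload y d xs

sum-unload : ∀ y d xs → sum (unload y d xs) ≡ d + sum xs
sum-unload y d [] = refl
sum-unload y d (x ∷ xs) with x ≤? y
... | yes _ rewrite +-comm x d = +-assoc d x (sum xs)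
... | no  _ rewrite sum-unload y d xs = solve 3 (λ x d s → x :+ (d :+ s) := d :+ (x :+ s)) refl x d (sum xs)

-- Each part above `y` met on the way is swapped to the front of both lists, and the step it stands
-- for is monotone in what follows.
walks-unload : ∀ y d xs ν h → walks (y + d ∷ xs ++ ν) h ≤ walks (y ∷ unload y d xs ++ ν) h
walks-unload y d [] ν h = walks-spread 0 y d ν h z≤n
walks-unload y d (x ∷ xs) ν h with x ≤? y
... | yes x≤y = walks-spread x y d (xs ++ ν) h x≤y
... | no  _
  rewrite walks-swap (y + d) x (xs ++ ν) h | walks-swap y x (unload y d xs ++ ν) h
  = clebschGordan-mono x h λ z → walks-unload y d xs ν z

-- Before the place where the surplus d is unloaded, every part of xs exceeds y
-- and hence the corresponding part of ys; from that place on nothing changes.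
unload-dominates : ∀ {y} d xs ys → All (_≤ y) ys → ∀ A B → B ≤ A →
  (∀ i → B + sum (take i ys) ≤ A + d + sum (take i xs)) →
  ∀ i → B + sum (take i ys) ≤ A + sum (take i (unload y d xs))
unload-dominates d xs ys ys≤ A B B≤A dom zero = +-monoˡ-≤ 0 B≤A
unload-dominates d [] ys ys≤ A B B≤A dom (suc i)
  rewrite take-[] {A = ℕ} i | +-identityʳ d = ≤-trans (dom (suc i)) (≤-reflexive (+-identityʳ (A + d)))
unload-dominates {y} d (x ∷ xs) ys ys≤ A B B≤A dom (suc i) with x ≤? y
... | yes _ = ≤-trans (dom (suc i)) (≤-reflexive
      (solve 4 (λ A d x s → A :+ d :+ (x :+ s) := A :+ (x :+ d :+ s)) refl A d x (sum (take i xs))))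
unload-dominates {y} d (x ∷ xs) [] ys≤ A B B≤A dom (suc i) | no _ =
  ≤-trans (+-monoˡ-≤ 0 B≤A) (+-monoʳ-≤ A z≤n)
unload-dominates {y} d (x ∷ xs) (z ∷ ys) (z≤y ∷ ys≤) A B B≤A dom (suc i) | no x≰y =
  subst₂ _≤_ (+-assoc B z _) (+-assoc A x _)
    (unload-dominates d xs ys ys≤ (A + x) (B + z)
      (+-mono-≤ B≤A (≤-trans z≤y (<⇒≤ (≰⇒> x≰y))))
      (λ j → subst₂ _≤_ (sym (+-assoc B z _))
               (solve 4 (λ A d x s → A :+ d :+ (x :+ s) := A :+ x :+ d :+ s) refl A d x (sum (take j xs)))
               (dom (suc j)))
      i)

-- Dominance gives `y ≤ x`. Unloading the surplus makes the first parts equal, does not decrease the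
-- count and keeps dominance on the rest. Since `κ` is decreasing, `y` bounds its remaining parts,
-- as `unload-dominates` requires.
walks-dominance : ∀ μ κ ν h → AllPairs _≥_ κ → sum μ ≡ sum κ → Dominates μ κ →
  walks (μ ++ ν) h ≤ walks (κ ++ ν) h
walks-dominance μ [] ν h _ eq _ = ≤-reflexive (walks-zeros-++ μ ν h eq)
walks-dominance [] (y ∷ κ) ν h _ eq _ =
  ≤-reflexive (sym (walks-zeros-++ (y ∷ κ) ν h (sym eq)))
walks-dominance (x ∷ μ) (y ∷ κ) ν h (y≥ ∷ κ↘) eq dom = begin
  walks (x ∷ μ ++ ν) h             ≡⟨ cong (λ x → walks (x ∷ μ ++ ν) h) x≡ ⟨
  walks (y + d ∷ μ ++ ν) h         ≤⟨ walks-unload y d μ ν h ⟩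
  walks (y ∷ unload y d μ ++ ν) h  ≤⟨ clebschGordan-mono y h (λ z → walks-dominance (unload y d μ) κ ν z κ↘ eq′ dom′) ⟩
  walks (y ∷ κ ++ ν) h             ∎
  where
  open ≤-Reasoning
  y≤x : y ≤ x
  y≤x = subst₂ _≤_ (+-identityʳ y) (+-identityʳ x) (dom 1)
  d = x ∸ y
  x≡ : y + d ≡ x
  x≡ = m+[n∸m]≡n y≤x
  regroup : ∀ s → y + (d + s) ≡ x + s
  regroup s = ≡.trans (sym (+-assoc y d s)) (cong (_+ s) x≡)
  eq′ : sum (unload y d μ) ≡ sum κ
  eq′ = ≡.trans (sum-unload y d μ) (+-cancelˡ-≡ y _ _ (≡.trans (regroup (sum μ)) eq))
  dom′ : Dominates (unload y d μ) κ
  dom′ = unload-dominates d μ κ y≥ 0 0 z≤n λ i →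
    +-cancelˡ-≤ y _ _ (≤-trans (dom (suc i)) (≤-reflexive (sym (regroup _))))

-- Enumerations

open Enumerates

private variable
  X Y : Set
  k l : ℕ

enumerates-≤ : {P : X → Set} → Enumerates P k → Enumerates P l → k ≤ l
enumerates-≤ e f = F.injective⇒≤ {f = λ i → proj₁ (complete f (elem e i) (sound e i))} λ {i} {j} eq →
  injective e i j (≡.trans (sym (proj₂ (complete f _ (sound e i))))
    (≡.trans (cong (elem f) eq) (proj₂ (complete f _ (sound e j)))))

enumerates-unique : {P : X → Set} → Enumerates P k → Enumerates P l → k ≡ l
enumerates-unique e f = ≤-antisym (enumerates-≤ e f) (enumerates-≤ f e)

enumerates-bij : {P : X → Set} {Q : Y → Set} (f : X → Y) (g : Y → X) →
  (∀ x → P x → Q (f x)) → (∀ y → Q y → P (g y)) →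
  (∀ x → P x → g (f x) ≡ x) → (∀ y → Q y → f (g y) ≡ y) →
  Enumerates P k → Enumerates Q k
enumerates-bij f g P→Q Q→P gf fg e = record
  { elem      = λ i → f (elem e i)
  ; sound     = λ i → P→Q _ (sound e i)
  ; complete  = λ y q → let (i , eq) = complete e (g y) (Q→P y q) in i , ≡.trans (cong f eq) (fg y q)
  ; injective = λ i j eq → injective e i j
      (≡.trans (sym (gf _ (sound e i))) (≡.trans (cong g eq) (gf _ (sound e j))))
  }

enumerates-resize : {P : X → Set} → k ≡ l → Enumerates P k → Enumerates P l
enumerates-resize refl e = e

enumerates-⇔ : {P Q : X → Set} → (∀ x → P x → Q x) → (∀ x → Q x → P x) → Enumerates P k → Enumerates Q k
enumerates-⇔ P→Q Q→P = enumerates-bij (λ x → x) (λ x → x) P→Q Q→P (λ _ _ → refl) (λ _ _ → refl)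

enumerates-∅ : {P : X → Set} → (∀ x → ¬ P x) → Enumerates P 0
enumerates-∅ ¬P = record
  { elem = λ () ; sound = λ () ; complete = λ x p → contradiction p (¬P x) ; injective = λ () }

enumerates-singleton : {P : X → Set} (x : X) → P x → (∀ y → P y → x ≡ y) → Enumerates P 1
enumerates-singleton x p unique = record
  { elem = λ _ → x ; sound = λ _ → p ; complete = λ y q → zero , unique y q
  ; injective = λ { zero zero _ → refl } }

enumerates-⊎ : {P Q R : X → Set} → (∀ x → P x → R x) → (∀ x → Q x → R x) →
  (∀ x → R x → P x ⊎ Q x) → (∀ x → P x → ¬ Q x) →
  Enumerates P k → Enumerates Q l → Enumerates R (k + l)
enumerates-⊎ {X} {k} {l} {P} {Q} {R} P→R Q→R R→ disjoint e f = record
  { elem      = λ i → el (splitAt k i)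
  ; sound     = λ i → so (splitAt k i)
  ; complete  = λ x r → co x (R→ x r)
  ; injective = λ i j → inj i j
  }
  where
  el : Fin k ⊎ Fin l → X
  el = [ elem e , elem f ]′
  so : ∀ s → R (el s)
  so (inj₁ i) = P→R _ (sound e i)
  so (inj₂ i) = Q→R _ (sound f i)
  co : ∀ x → P x ⊎ Q x → ∃ λ i → el (splitAt k i) ≡ x
  co x (inj₁ p) = let (i , eq) = complete e x p in i ↑ˡ l , ≡.trans (cong el (F.splitAt-↑ˡ k i l)) eq
  co x (inj₂ q) = let (i , eq) = complete f x q in k ↑ʳ i , ≡.trans (cong el (F.splitAt-↑ʳ k l i)) eq
  inj : ∀ i j → el (splitAt k i) ≡ el (splitAt k j) → i ≡ j
  inj i j eq with splitAt k i in eqi | splitAt k j in eqj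
  ... | inj₁ a | inj₁ b = ≡.trans (sym (F.splitAt⁻¹-↑ˡ eqi)) (≡.trans (cong (_↑ˡ l) (injective e a b eq)) (F.splitAt⁻¹-↑ˡ eqj))
  ... | inj₁ a | inj₂ b = contradiction (sound f b) (disjoint _ (subst P eq (sound e a)))
  ... | inj₂ a | inj₁ b = contradiction (sound f a) (disjoint _ (subst P (sym eq) (sound e b)))
  ... | inj₂ a | inj₂ b = ≡.trans (sym (F.splitAt⁻¹-↑ʳ eqi)) (≡.trans (cong (k ↑ʳ_) (injective f a b eq)) (F.splitAt⁻¹-↑ʳ eqj))

-- Multisets and weakly increasing lists

msetFrom-≥ : ∀ k μ → All (k ≤_) (msetFrom k μ)
msetFrom-≥ k []      = []
msetFrom-≥ k (m ∷ μ) = All.++⁺ (All.replicate⁺ m ≤-refl) (All.map <⇒≤ (msetFrom-≥ (suc k) μ))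

length-msetFrom : ∀ k μ → length (msetFrom k μ) ≡ sum μ
length-msetFrom k []      = refl
length-msetFrom k (m ∷ μ) = ≡.trans (length-++ (replicate m k))
  (cong₂ _+_ (length-replicate m) (length-msetFrom (suc k) μ))

WeaklyIncr⇒AllPairs : ∀ {xs} → WeaklyIncr xs → AllPairs _≤_ xs
WeaklyIncr⇒AllPairs = Linked⇒AllPairs ≤-trans

WeaklyIncr-∷ : ∀ {x xs} → All (x ≤_) xs → WeaklyIncr xs → WeaklyIncr (x ∷ xs)
WeaklyIncr-∷ x≤ w = AllPairs⇒Linked (x≤ ∷ WeaklyIncr⇒AllPairs w)

WeaklyIncr-tail : ∀ {x xs} → WeaklyIncr (x ∷ xs) → WeaklyIncr xs
WeaklyIncr-tail w = AllPairs⇒Linked (AllPairs.tail (WeaklyIncr⇒AllPairs w))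

WeaklyIncr-head : ∀ {x xs} → WeaklyIncr (x ∷ xs) → All (x ≤_) xs
WeaklyIncr-head w = AllPairs.head (WeaklyIncr⇒AllPairs w)

∉-≥ : ∀ {x xs} → All (suc x ≤_) xs → x ∉ xs
∉-≥ a x∈ = <-irrefl refl (All.lookup a x∈)

≥∧∉⇒> : ∀ {x xs} → All (x ≤_) xs → x ∉ xs → All (suc x ≤_) xs
≥∧∉⇒> []        x∉ = []
≥∧∉⇒> (p ∷ all) x∉ = ≤∧≢⇒< p (λ { refl → x∉ (here refl) }) ∷ ≥∧∉⇒> all (λ x∈ → x∉ (there x∈))

-- Kostka numbers of two-row shapes

-- Two-row tableaux whose entries below k have been removed: t is what remains
-- of the first row once its removed cells above removed cells are discarded.
record Rest (t : List ℕ) (k : ℕ) (μ : List ℕ) (rows : List ℕ × List ℕ) : Set where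
  constructor rest
  r₁ = proj₁ rows
  r₂ = proj₂ rows
  field
    incr₁ : WeaklyIncr r₁
    incr₂ : WeaklyIncr r₂
    len   : length r₂ ≡ length t + length r₁
    below : Below (t ++ r₁) r₂
    perm  : r₁ ++ r₂ ↭ msetFrom k μ

  entries-≥ : All (k ≤_) (r₁ ++ r₂)
  entries-≥ = All-resp-↭ (↭-sym perm) (msetFrom-≥ k μ)

-- Since `r` increases and is bounded below by `k`, every copy of `k` in it stands at its front, and
-- `s` can supply none of the `m` copies.
peel : ∀ m k r s z → WeaklyIncr r → All (k ≤_) r → k ∉ s → r ++ s ↭ replicate m k ++ z →
  ∃ λ r′ → r ≡ replicate m k ++ r′ × r′ ++ s ↭ z
peel zero    k r       s z w r≥ k∉ p = r , refl , p
peel (suc m) k []      s z w r≥ k∉ p = contradiction (∈-resp-↭ (↭-sym p) (here refl)) k∉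
peel (suc m) k (x ∷ r) s z w (k≤x ∷ r≥) k∉ p
  with ≤-antisym k≤x (x≤k (∈-++⁻ (x ∷ r) (∈-resp-↭ (↭-sym p) (here refl))))
  where
  x≤k : k ∈ (x ∷ r) ⊎ k ∈ s → x ≤ k
  x≤k (inj₁ (here refl)) = ≤-refl
  x≤k (inj₁ (there k∈))  = All.lookup (WeaklyIncr-head w) k∈
  x≤k (inj₂ k∈)          = contradiction k∈ k∉
... | refl = let (r′ , eq , q) = peel m k r s z (WeaklyIncr-tail w) r≥ k∉ (drop-∷ p)
             in r′ , cong (k ∷_) eq , q

WeaklyIncr-replicate : ∀ m {k r} → All (k ≤_) r → WeaklyIncr r → WeaklyIncr (replicate m k ++ r)
WeaklyIncr-replicate zero    k≤ w = w
WeaklyIncr-replicate (suc m) k≤ w =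
  WeaklyIncr-∷ (All.++⁺ (All.replicate⁺ m ≤-refl) k≤) (WeaklyIncr-replicate m k≤ w)

module _ (k : ℕ) (μ : List ℕ) where

  -- If the second row has no `k`, all `m` copies open the first row. Nothing stands below them yet,
  -- so they join the overhang.
  Rest-absent : ∀ t m {n} → Enumerates (Rest (t ++ replicate m k) (suc k) μ) n →
    Enumerates (λ rows → Rest t k (m ∷ μ) rows × k ∉ proj₂ rows) n
  Rest-absent t m = enumerates-bij
    (λ (r₁ , r₂) → replicate m k ++ r₁ , r₂) (λ (r₁ , r₂) → drop m r₁ , r₂)
    (λ (r₁ , r₂) ρ → add r₁ r₂ ρ) (λ (r₁ , r₂) (ρ , k∉) → remove r₁ r₂ ρ k∉)
    (λ (r₁ , r₂) _ → cong (_, r₂) (drop-replicate m r₁))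
    (λ { (r₁ , r₂) (ρ , k∉) → cong (_, r₂) (restore r₁ r₂ ρ k∉) })
    where
    drop-replicate : ∀ m r → drop m (replicate m k ++ r) ≡ r
    drop-replicate zero    r = refl
    drop-replicate (suc m) r = drop-replicate m r
    peeled : ∀ r₁ r₂ → Rest t k (m ∷ μ) (r₁ , r₂) → k ∉ r₂ →
      ∃ λ r → r₁ ≡ replicate m k ++ r × r ++ r₂ ↭ msetFrom (suc k) μ
    peeled r₁ r₂ ρ k∉ = peel m k r₁ r₂ _ incr₁ (All.++⁻ˡ r₁ entries-≥) k∉ perm
      where open Rest ρ hiding (r₁; r₂)
    length-move : ∀ r → length (t ++ replicate m k) + length r ≡ length t + length (replicate m k ++ r)
    length-move r rewrite length-++ t {replicate m k} | length-++ (replicate m k) {r} = +-assoc (length t) _ _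
    add : ∀ r₁ r₂ → Rest (t ++ replicate m k) (suc k) μ (r₁ , r₂) →
      Rest t k (m ∷ μ) (replicate m k ++ r₁ , r₂) × k ∉ r₂
    add r₁ r₂ ρ = record
      { incr₁ = WeaklyIncr-replicate m (All.map <⇒≤ (All.++⁻ˡ r₁ entries-≥)) incr₁
      ; incr₂ = incr₂
      ; len   = ≡.trans len (length-move r₁)
      ; below = subst (λ r → Below r r₂) (++-assoc t (replicate m k) r₁) below
      ; perm  = ↭-trans (↭-reflexive (++-assoc (replicate m k) r₁ r₂)) (Perm.++⁺ˡ (replicate m k) perm)
      } , ∉-≥ (All.++⁻ʳ r₁ entries-≥)
      where open Rest ρ hiding (r₁; r₂)
    remove : ∀ r₁ r₂ → Rest t k (m ∷ μ) (r₁ , r₂) → k ∉ r₂ →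
      Rest (t ++ replicate m k) (suc k) μ (drop m r₁ , r₂)
    remove r₁ r₂ ρ k∉ with peeled r₁ r₂ ρ k∉
    ... | r , refl , p rewrite drop-replicate m r = record
      { incr₁ = suffix m (Rest.incr₁ ρ)
      ; incr₂ = Rest.incr₂ ρ
      ; len   = ≡.trans (Rest.len ρ) (sym (length-move r))
      ; below = subst (λ r → Below r r₂) (sym (++-assoc t (replicate m k) r)) (Rest.below ρ)
      ; perm  = p
      }
      where
      suffix : ∀ m → WeaklyIncr (replicate m k ++ r) → WeaklyIncr r
      suffix zero    w = w
      suffix (suc m) w = suffix m (WeaklyIncr-tail w)
    restore : ∀ r₁ r₂ → Rest t k (m ∷ μ) (r₁ , r₂) → k ∉ r₂ → replicate m k ++ drop m r₁ ≡ r₁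
    restore r₁ r₂ ρ k∉ with peeled r₁ r₂ ρ k∉
    ... | r , refl , _ = cong (replicate m k ++_) (drop-replicate m r)

  -- A `k` heading the second row stands under `x`. Discarding this column uses up one copy of `k`
  -- and one cell of the overhang.
  Rest-present : ∀ x t m {n} → x < k → Enumerates (Rest t k (m ∷ μ)) n →
    Enumerates (λ rows → Rest (x ∷ t) k (suc m ∷ μ) rows × ∃ λ r → proj₂ rows ≡ k ∷ r) n
  Rest-present x t m x<k = enumerates-bij
    (λ (r₁ , r₂) → r₁ , k ∷ r₂) (λ (r₁ , r₂) → r₁ , drop 1 r₂)
    (λ (r₁ , r₂) ρ → let open Rest ρ hiding (r₁; r₂) in record
      { incr₁ = incr₁
      ; incr₂ = WeaklyIncr-∷ (All.++⁻ʳ r₁ entries-≥) incr₂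
      ; len   = cong suc len
      ; below = x<k , below
      ; perm  = ↭-trans (shift k r₁ r₂) (prep k perm)
      } , r₂ , refl)
    (λ { (r₁ , _) (ρ , r₂ , refl) → let open Rest ρ hiding (r₁; r₂) in record
      { incr₁ = incr₁
      ; incr₂ = WeaklyIncr-tail incr₂
      ; len   = suc-injective len
      ; below = proj₂ below
      ; perm  = drop-∷ (↭-trans (↭-sym (shift k r₁ r₂)) perm)
      } })
    (λ _ _ → refl)
    (λ { (r₁ , _) (ρ , r₂ , refl) → refl })

  present-or-absent : ∀ t m r₁ r₂ → Rest t k (m ∷ μ) (r₁ , r₂) → (∃ λ r → r₂ ≡ k ∷ r) ⊎ k ∉ r₂
  present-or-absent t m r₁ []       ρ = inj₂ λ ()
  present-or-absent t m r₁ (y ∷ r₂) ρ with y ≟ k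
  ... | yes refl = inj₁ (r₂ , refl)
  ... | no  y≢k  = inj₂ (∉-≥ (k<y ∷ All.map (<-≤-trans k<y) (WeaklyIncr-head (Rest.incr₂ ρ))))
    where
    k<y : k < y
    k<y = ≤∧≢⇒< (All.head (All.++⁻ʳ r₁ (Rest.entries-≥ ρ))) (λ eq → y≢k (sym eq))

  -- Absence and presence of `k` in the second row are the two summands in the last clause of
  -- `clebschGordan`. With no overhang only absence is possible: a `k` heading the second row would
  -- stand under an entry that is at least `k`.
  enumerates-Rest-step : (∀ t → All (_< suc k) t → Enumerates (Rest t (suc k) μ) (walks μ (length t))) →
    ∀ t m → All (_< k) t → Enumerates (Rest t k (m ∷ μ)) (walks (m ∷ μ) (length t))
  enumerates-Rest-step ih = go
    where
    absent : ∀ t m → All (_< k) t →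
      Enumerates (λ rows → Rest t k (m ∷ μ) rows × k ∉ proj₂ rows) (walks μ (m + length t))
    absent t m t<k = Rest-absent t m (enumerates-resize (cong (walks μ) lengths)
      (ih (t ++ replicate m k) (All.++⁺ (All.map m<n⇒m<1+n t<k) (All.replicate⁺ m (n<1+n k)))))
      where
      lengths : length (t ++ replicate m k) ≡ m + length t
      lengths rewrite length-++ t {replicate m k} | length-replicate m {k} = +-comm (length t) m

    go : ∀ t m → All (_< k) t → Enumerates (Rest t k (m ∷ μ)) (walks (m ∷ μ) (length t))
    go t zero t<k = enumerates-⇔ (λ _ → proj₁)
      (λ (r₁ , r₂) ρ → ρ , λ k∈ → ∉-≥ (msetFrom-≥ (suc k) μ) (∈-resp-↭ (Rest.perm ρ) (∈-++⁺ʳ r₁ k∈)))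
      (absent t zero t<k)
    go [] (suc m) [] = enumerates-resize (cong (walks μ) (+-identityʳ (suc m)))
      (enumerates-⇔ (λ _ → proj₁) (λ (r₁ , r₂) ρ → ρ , headless r₁ r₂ ρ) (absent [] (suc m) []))
      where
      headless : ∀ r₁ r₂ → Rest [] k (suc m ∷ μ) (r₁ , r₂) → k ∉ r₂
      headless r₁ r₂ ρ with present-or-absent [] (suc m) r₁ r₂ ρ
      ... | inj₂ k∉ = k∉
      headless []       _ ρ | inj₁ (r , refl) = ⊥-elim (Rest.below ρ)
      headless (x ∷ r₁) _ ρ | inj₁ (r , refl) =
        contradiction (All.head (Rest.entries-≥ ρ)) (<⇒≱ (proj₁ (Rest.below ρ)))
    go (x ∷ t) (suc m) (x<k ∷ t<k) = enumerates-⊎ (λ _ → proj₁) (λ _ → proj₁)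
      (λ (r₁ , r₂) ρ → [ (λ p → inj₂ (ρ , p)) , (λ k∉ → inj₁ (ρ , k∉)) ]′ (present-or-absent _ _ r₁ r₂ ρ))
      (λ { _ (_ , k∉) (_ , r , refl) → k∉ (here refl) })
      (absent (x ∷ t) (suc m) (x<k ∷ t<k))
      (Rest-present x t m x<k (go t m t<k))

enumerates-Rest : ∀ μ k t → All (_< k) t → Enumerates (Rest t k μ) (walks μ (length t))
enumerates-Rest []      k []      t<k = enumerates-singleton ([] , [])
  (rest [] [] refl tt ↭-refl) λ { (r₁ , r₂) ρ → sym (empty (Rest.perm ρ)) }
  where
  empty : ∀ {r₁ r₂ : List ℕ} → r₁ ++ r₂ ↭ [] → (r₁ , r₂) ≡ ([] , [])
  empty {[]} {[]} p = refl
  empty {[]} {_ ∷ _} p = contradiction p ¬x∷xs↭[]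
  empty {_ ∷ _} p = contradiction p ¬x∷xs↭[]
-- With no entries left the overhang cannot be covered, just as a walk must not end above 0.
enumerates-Rest []      k (x ∷ t) t<k = enumerates-∅ λ (r₁ , r₂) ρ → nonempty r₁ r₂ ρ
  where
  nonempty : ∀ r₁ r₂ → ¬ Rest (x ∷ t) k [] (r₁ , r₂)
  nonempty []      []      (rest _ _ () _ _)
  nonempty []      (_ ∷ _) (rest _ _ _ _ p) = ¬x∷xs↭[] p
  nonempty (_ ∷ _) _       (rest _ _ _ _ p) = ¬x∷xs↭[] p
enumerates-Rest (m ∷ μ) k t       t<k =
  enumerates-Rest-step k μ (enumerates-Rest μ (suc k)) t m t<k

kostka-twoRow : ∀ μ N → sum μ ≡ N + N → Kostka (twoRow N) μ (walks μ 0)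
kostka-twoRow μ N eq = enumerates-bij
  (λ (r₁ , r₂) → r₁ ∷ r₂ ∷ []) rows
  (λ (r₁ , r₂) ρ → let open Rest ρ hiding (r₁; r₂) in
    cong₂ (λ x y → x ∷ y ∷ []) (half r₁ r₂ len (↭-length perm)) (≡.trans len (half r₁ r₂ len (↭-length perm)))
    , incr₁ ∷ incr₂ ∷ [] , below ∷ [-]
    , ↭-trans (↭-reflexive (cong (r₁ ++_) (++-identityʳ r₂))) perm)
  to-Rest
  (λ _ _ → refl)
  (λ { (_ ∷ _ ∷ []) _ → refl ; [] (() , _) ; (_ ∷ []) (() , _) ; (_ ∷ _ ∷ _ ∷ _) (() , _) })
  (enumerates-Rest μ 1 [] [])
  where
  rows : List (List ℕ) → List ℕ × List ℕ
  rows (r₁ ∷ r₂ ∷ _) = r₁ , r₂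
  -- A tableau of this shape has exactly two rows, so this default is never met.
  rows _             = [] , []
  half : ∀ (r₁ r₂ : List ℕ) → length r₂ ≡ length r₁ → length (r₁ ++ r₂) ≡ length (mset μ) → length r₁ ≡ N
  half r₁ r₂ e l rewrite length-++ r₁ {r₂} | e | length-msetFrom 1 μ | eq = double _ _ l
    where
    double : ∀ m n → m + m ≡ n + n → m ≡ n
    double m n e with <-cmp m n
    ... | tri< m<n _ _ = contradiction e (<⇒≢ (+-mono-< m<n m<n))
    ... | tri≈ _ m≡n _ = m≡n
    ... | tri> _ _ n<m = contradiction (sym e) (<⇒≢ (+-mono-< n<m n<m))
  to-Rest : ∀ T → SSYT (twoRow N) μ T → Rest [] 1 μ (rows T)
  to-Rest (r₁ ∷ r₂ ∷ []) (len , (w₁ ∷ w₂ ∷ []) , (b ∷ _) , p) =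
    rest w₁ w₂ (≡.trans (∷-injectiveˡ (∷-injectiveʳ len)) (sym (∷-injectiveˡ len))) b
      (↭-trans (↭-reflexive (cong (r₁ ++_) (sym (++-identityʳ r₂)))) p)

-- Avoiding a peak followed by a prescribed descent or ascent

WeaklyIncr-↭⇒≡ : ∀ {xs ys} → WeaklyIncr xs → WeaklyIncr ys → xs ↭ ys → xs ≡ ys
WeaklyIncr-↭⇒≡ w v p = Pointwise-≡⇒≡ (↗↭↗⇒≋ ≤-totalOrder w v (↭⇒↭ₛ p))

drop-prefix : ∀ (xs : List ℕ) {ys zs} → xs ++ ys ↭ xs ++ zs → ys ↭ zs
drop-prefix []       p = p
drop-prefix (x ∷ xs) p = drop-prefix xs (drop-∷ p)

cut : ∀ c {xs} → WeaklyIncr xs → ∃ λ lo → ∃ λ hi →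
  xs ≡ lo ++ hi × All (_< c) lo × All (c ≤_) hi × WeaklyIncr lo × WeaklyIncr hi
cut c {[]}     w = [] , [] , refl , [] , [] , [] , []
cut c {x ∷ xs} w with x <? c
... | no x≮c = [] , x ∷ xs , refl , [] , (≮⇒≥ x≮c ∷ All.map (≤-trans (≮⇒≥ x≮c)) (WeaklyIncr-head w)) , [] , w
... | yes x<c with cut c (WeaklyIncr-tail w)
...   | lo , hi , refl , lo< , ≤hi , wlo , whi =
        x ∷ lo , hi , refl , x<c ∷ lo< , ≤hi , WeaklyIncr-∷ (All.++⁻ˡ lo (WeaklyIncr-head w)) wlo , whi

WeaklyIncr-glue : ∀ {c lo hi} → All (_< c) lo → All (c ≤_) hi → WeaklyIncr lo → WeaklyIncr hi → WeaklyIncr (lo ++ hi)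
WeaklyIncr-glue lo< ≤hi wlo whi = AllPairs⇒Linked (AllPairs.++⁺ (WeaklyIncr⇒AllPairs wlo) (WeaklyIncr⇒AllPairs whi)
  (All.map (λ x<c → All.map (λ c≤y → <⇒≤ (<-≤-trans x<c c≤y)) ≤hi) lo<))

cut-unique : ∀ {c} lo lo′ {hi hi′} → All (_< c) lo → All (c ≤_) hi → All (_< c) lo′ → All (c ≤_) hi′ →
  lo ++ hi ≡ lo′ ++ hi′ → lo ≡ lo′
cut-unique []       []         _          _        _           _         _    = refl
cut-unique []       (_ ∷ _)    _          (c≤ ∷ _) (<c ∷ _)    _         refl = contradiction c≤ (<⇒≱ <c)
cut-unique (_ ∷ _)  []         (<c ∷ _)   _        _           (c≤ ∷ _)  refl = contradiction c≤ (<⇒≱ <c)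
cut-unique (x ∷ lo) (x′ ∷ lo′) (_ ∷ lo<)  ≤hi      (_ ∷ lo<′)  ≤hi′      eq   =
  cong₂ _∷_ (∷-injectiveˡ eq) (cut-unique lo lo′ lo< ≤hi lo<′ ≤hi′ (∷-injectiveʳ eq))

drop-++ : ∀ (xs ys : List ℕ) → drop (length xs) (xs ++ ys) ≡ ys
drop-++ []       ys = refl
drop-++ (_ ∷ xs) ys = drop-++ xs ys

module _ {A : Set} {R : A → A → Set} where

  AllPairs-++⁻ˡ : ∀ xs {ys} → AllPairs R (xs ++ ys) → AllPairs R xs
  AllPairs-++⁻ˡ []       _        = []
  AllPairs-++⁻ˡ (_ ∷ xs) (r ∷ rs) = All.++⁻ˡ xs r ∷ AllPairs-++⁻ˡ xs rs

  AllPairs-++⁻ˣ : ∀ xs {ys} → AllPairs R (xs ++ ys) → All (λ x → All (R x) ys) xs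
  AllPairs-++⁻ˣ []       _        = []
  AllPairs-++⁻ˣ (_ ∷ xs) (r ∷ rs) = All.++⁻ʳ xs r ∷ AllPairs-++⁻ˣ xs rs

  AllPairs-resp-⊆ : ∀ {xs ys} → xs ⊆ ys → AllPairs R ys → AllPairs R xs
  AllPairs-resp-⊆ []         []       = []
  AllPairs-resp-⊆ (_ ∷ʳ s)   (_ ∷ rs) = AllPairs-resp-⊆ s rs
  AllPairs-resp-⊆ (refl ∷ s) (r ∷ rs) = All-resp-⊆ s r ∷ AllPairs-resp-⊆ s rs

  AllPairs-from-⊆ : ∀ xs → (∀ {x y} → x ∷ y ∷ [] ⊆ xs → R x y) → AllPairs R xs
  AllPairs-from-⊆ []       r = []
  AllPairs-from-⊆ (x ∷ xs) r =
    All.tabulate (λ y∈ → r (refl ∷ from∈ y∈)) ∷ AllPairs-from-⊆ xs (λ s → r (x ∷ʳ s))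

  AllPairs-replicate : ∀ n {x} → R x x → AllPairs R (replicate n x)
  AllPairs-replicate zero    r = []
  AllPairs-replicate (suc n) r = All.replicate⁺ n r ∷ AllPairs-replicate n r

  AllPairs-reverse : ∀ {xs} → AllPairs R xs → AllPairs (λ x y → R y x) (reverse xs)
  AllPairs-reverse {[]}     []       = []
  AllPairs-reverse {x ∷ xs} (r ∷ rs) rewrite unfold-reverse x xs =
    AllPairs.++⁺ (AllPairs-reverse rs) ([] ∷ [])
      (All.map (_∷ []) (All-resp-↭ (↭-sym (↭-reverse xs)) r))

-- The three blocks are given as a sublist and not by indices, so that `reverse` and `map` act on
-- occurrences directly.
Occurs : (ℕ → ℕ → ℕ → Set) → List (List ℕ) → Set
Occurs Q τ = ∃ λ B₁ → ∃ λ B₂ → ∃ λ B₃ → B₁ ∷ B₂ ∷ B₃ ∷ [] ⊆ τ ×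
  ∃ λ x → ∃ λ y → ∃ λ z → x ∈ B₁ × y ∈ B₂ × z ∈ B₃ × Q x y z

-- The common part of two avoidance problems. Pending values must appear in `⊑`-order and are listed
-- in that order; `arrange` puts those taken by one block into weakly increasing order, and `push`
-- adds copies of a value larger than all pending ones.
module Pending
  (_⊑_          : ℕ → ℕ → Set)
  (_⊑?_         : ∀ x y → Dec (x ⊑ y))
  (⊑-antisym    : ∀ {x y} → x ⊑ y → y ⊑ x → x ≡ y)
  (arrange      : List ℕ → List ℕ)
  (arrange-↭    : ∀ xs → arrange xs ↭ xs)
  (arrange-incr : ∀ {xs} → AllPairs _⊑_ xs → WeaklyIncr (arrange xs))
  (push         : List ℕ → List ℕ → List ℕ)
  (push-↭       : ∀ p q → push p q ↭ p ++ q)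
  (push-sorted  : ∀ {c p} b → All (_< c) p → AllPairs _⊑_ p → AllPairs _⊑_ (push p (replicate b c)))
  where

  OrderedBelow : ℕ → List ℕ → List ℕ → Set
  OrderedBelow c B C = ∀ y z → y ∈ B → z ∈ C → y < c → z < c → y ⊑ z

  Ord : ℕ → List (List ℕ) → Set
  Ord c = AllPairs (OrderedBelow c)

  -- Avoidance of a pattern whose first entry is the largest: after `x`, the smaller entries of
  -- later blocks are in `⊑`-order. Only entries of distinct blocks are compared.
  NoPeak : List (List ℕ) → Set
  NoPeak []      = ⊤
  NoPeak (B ∷ τ) = All (λ x → Ord x τ) B × NoPeak τ

  Ord-mono : ∀ {c d τ} → c ≤ d → Ord d τ → Ord c τ
  Ord-mono c≤d = AllPairs.map λ o y z y∈ z∈ y<c z<c → o y z y∈ z∈ (<-≤-trans y<c c≤d) (<-≤-trans z<c c≤d)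

  Inv : List ℕ → ℕ → Set
  Inv p c = All (_< c) p × AllPairs _⊑_ p

  -- B is the part with entries ≥ c of the current block and τ the blocks after it.
  -- The values < c still to be placed are those in p; having read an entry ≥ c
  -- forces them to appear in ⊑-order.
  record Tail (p : List ℕ) (c : ℕ) (β α : List ℕ) (B : List ℕ) (τ : List (List ℕ)) : Set where
    field
      incr  : WeaklyIncr B
      above : All (c ≤_) B
      perm  : B ++ concat τ ↭ p ++ msetFrom c β
      lens  : map length τ ≡ α
      incrs : All WeaklyIncr τ
      peaks : NoPeak τ
      ords  : All (λ x → Ord x τ) B
      ord   : Ord c τ

  Block : List ℕ → ℕ → List ℕ → List ℕ → ℕ → List ℕ × List (List ℕ) → Set
  Block p c β α a (B , τ) = length B ≡ a × Tail p c β α B τ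

  push-Inv : ∀ {p c} b → Inv p c → Inv (push p (replicate b c)) (suc c)
  push-Inv {p} {c} b (p<c , p↗) =
    All-resp-↭ (↭-sym (push-↭ p (replicate b c)))
      (All.++⁺ (All.map m<n⇒m<1+n p<c) (All.replicate⁺ b (n<1+n c)))
    , push-sorted b p<c p↗

  -- The entries of a block from `c` on

  module _ {p : List ℕ} {c : ℕ} {β α : List ℕ} where

    nonempty-ord : ∀ {d B τ a} → length B ≡ suc a → All (d ≤_) B → All (λ x → Ord x τ) B → Ord d τ
    nonempty-ord {B = _ ∷ _} _ (d≤ ∷ _) (o ∷ _) = Ord-mono d≤ o

    -- If the nonempty rest of the block has no `c`, its first entry exceeds `c` and forces all
    -- values up to `c` into `⊑`-order in later blocks. So the `b` copies of `c` become pending and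
    -- the threshold rises to `suc c`.
    skip-value : ∀ {q b a n} → q ↭ p ++ replicate b c →
      Enumerates (Block q (suc c) β α (suc a)) n →
      Enumerates (λ (B , τ) → Block p c (b ∷ β) α (suc a) (B , τ) × c ∉ B) n
    skip-value {q} {b} q↭ = enumerates-⇔
      (λ (B , τ) (len , t) → let open Tail t in (len , record
        { incr = incr ; above = All.map <⇒≤ above ; perm = ↭-trans perm q≈ ; lens = lens
        ; incrs = incrs ; peaks = peaks ; ords = ords ; ord = Ord-mono (n≤1+n c) ord }) , ∉-≥ above)
      (λ (B , τ) ((len , t) , c∉) → let open Tail t in len , record
        { incr = incr ; above = ≥∧∉⇒> above c∉ ; perm = ↭-trans perm (↭-sym q≈) ; lens = lens
        ; incrs = incrs ; peaks = peaks ; ords = ords ; ord = nonempty-ord len (≥∧∉⇒> above c∉) ords })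
      where
      q≈ : q ++ msetFrom (suc c) β ↭ p ++ replicate b c ++ msetFrom (suc c) β
      q≈ = ↭-trans (Perm.++⁺ʳ _ q↭) (↭-reflexive (++-assoc p (replicate b c) _))

    -- A further entry `c` in the block asks for `Ord c τ`, which `Tail` already contains.
    take-value : ∀ {b a n} → Enumerates (Block p c (b ∷ β) α a) n →
      Enumerates (λ (B , τ) → Block p c (suc b ∷ β) α (suc a) (B , τ) × ∃ λ B′ → B ≡ c ∷ B′) n
    take-value {b} = enumerates-bij (λ (B , τ) → c ∷ B , τ) (λ (B , τ) → drop 1 B , τ)
      (λ (B , τ) (len , t) → let open Tail t in (cong suc len , record
        { incr = WeaklyIncr-∷ above incr ; above = ≤-refl ∷ above
        ; perm = ↭-trans (prep c perm) (↭-sym (shift c p _)) ; lens = lens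
        ; incrs = incrs ; peaks = peaks ; ords = ord ∷ ords ; ord = ord }) , B , refl)
      (λ { (_ , τ) ((len , t) , B , refl) → let open Tail t in suc-injective len , record
        { incr = WeaklyIncr-tail incr ; above = All.tail above
        ; perm = drop-∷ (↭-trans perm (shift c p _)) ; lens = lens
        ; incrs = incrs ; peaks = peaks ; ords = All.tail ords ; ord = ord } })
      (λ _ _ → refl)
      (λ { (_ , τ) (_ , B , refl) → refl })

    taken-or-skipped : ∀ {b a B τ} → Block p c (b ∷ β) α (suc a) (B , τ) → (∃ λ B′ → B ≡ c ∷ B′) ⊎ c ∉ B
    taken-or-skipped {B = x ∷ B} (_ , t) with x ≟ c
    ... | yes refl = inj₁ (B , refl)
    ... | no  x≢c  = inj₂ (∉-≥ (c<x ∷ All.map (<-≤-trans c<x) (WeaklyIncr-head (Tail.incr t))))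
      where
      c<x : c < x
      c<x = ≤∧≢⇒< (All.head (Tail.above t)) (λ eq → x≢c (sym eq))

  -- The order of the pending values is prescribed, so only their number enters, as one more part
  -- beside those of `β`.
  Counted : List ℕ → Set
  Counted α = ∀ {p c} β → Inv p c → sum α ≡ length p + sum β →
    Enumerates (Tail p c β α []) (walks (length p ∷ β ++ α) 0)

  -- The first step of the walk leads from 0 to `a + length p`. At the next part of `β`, skipping
  -- and taking `c` are the two summands of `clebschGordan`.
  enumerates-Block : ∀ {α} → Counted α → ∀ β {p c} a → Inv p c → a + sum α ≡ length p + sum β →
    Enumerates (Block p c β α a) (walks (a + length p ∷ β ++ α) 0)
  enumerates-Block ih β zero inv eq = enumerates-bij ([] ,_) proj₂
    (λ τ t → refl , t) (λ { ([] , τ) (_ , t) → t })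
    (λ _ _ → refl) (λ { ([] , τ) _ → refl }) (ih β inv eq)
  enumerates-Block {α} ih [] {p} {c} (suc a) (p<c , _) eq = enumerates-resize
    -- No value from `c` on is left to fill the block. On the other side the height exceeds `sum α`,
    -- so the walk cannot return to 0.
    (sym (walks-vanish α (suc a + length p) few))
    (enumerates-∅ λ { ([] , τ) (() , _) ; (x ∷ B , τ) (_ , t) →
      contradiction (All.head (Tail.above t))
        (<⇒≱ (All.lookup p<c (subst (x ∈_) (++-identityʳ p) (∈-resp-↭ (Tail.perm t) (here refl))))) })
    where
    few : sum α < suc a + length p
    few = s≤s (≤-trans (m≤n+m (sum α) (suc a)) (≤-trans (≤-reflexive (≡.trans eq (+-identityʳ _))) (m≤n+m _ a)))
  enumerates-Block ih (zero ∷ β) {p} {c} (suc a) (p<c , p↗) eq = enumerates-⇔ (λ _ → proj₁)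
    (λ (B , τ) (len , t) → (len , t) , λ c∈ → [ (λ c∈p → <-irrefl refl (All.lookup p<c c∈p)) , ∉-≥ (msetFrom-≥ (suc c) β) ]′
      (∈-++⁻ p (∈-resp-↭ (Tail.perm t) (∈-++⁺ˡ c∈))))
    (skip-value (↭-reflexive (sym (++-identityʳ p)))
      (enumerates-Block ih β (suc a) (All.map m<n⇒m<1+n p<c , p↗) eq))
  enumerates-Block {α} ih (suc b ∷ β) {p} {c} (suc a) inv eq = enumerates-resize sizes
    (enumerates-⊎ (λ _ → proj₁) (λ _ → proj₁)
      (λ _ t → [ (λ taken → inj₂ (t , taken)) , (λ c∉ → inj₁ (t , c∉)) ]′ (taken-or-skipped t))
      (λ { _ (_ , c∉) (_ , B , refl) → c∉ (here refl) })
      (skip-value (push-↭ p _) (enumerates-Block ih β (suc a) (push-Inv (suc b) inv) eq-skip))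
      (take-value (enumerates-Block ih (b ∷ β) a inv eq-take)))
    where
    pushed = push p (replicate (suc b) c)
    pushed-length : length pushed ≡ length p + suc b
    pushed-length = ≡.trans (↭-length (push-↭ p _)) (≡.trans (length-++ p) (cong (length p +_) (length-replicate (suc b))))
    eq-skip : suc a + sum α ≡ length pushed + sum β
    eq-skip rewrite pushed-length = ≡.trans eq (sym (+-assoc (length p) (suc b) (sum β)))
    eq-take : a + sum α ≡ length p + (b + sum β)
    eq-take = suc-injective (≡.trans eq (+-suc (length p) (b + sum β)))
    sizes : walks (suc a + length pushed ∷ β ++ α) 0 + walks (a + length p ∷ b ∷ β ++ α) 0
          ≡ walks (suc a + length p ∷ suc b ∷ β ++ α) 0
    sizes = cong₂ _+_
      (cong (walks (β ++ α)) (≡.trans (cong (suc a +_) pushed-length)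
        (solve 3 (λ a l b → con 1 :+ a :+ (l :+ (con 1 :+ b)) := con 1 :+ b :+ (con 1 :+ (a :+ l))) refl a (length p) b)))
      (clebschGordan-zeroʳ (a + length p) (walks (b ∷ β ++ α)))

  -- The first element `x` of `p` must lie in `u`: if it lay in `w`, any `y` in `u` would satisfy
  -- `y ⊑ x` and `x ⊑ y`, hence equal it. Removing `x` from both sides gives the induction.
  split-sorted : ∀ p u w → AllPairs _⊑_ p → u ++ w ↭ p → (∀ {y z} → y ∈ u → z ∈ w → y ⊑ z) →
    ∃ λ f → ∃ λ r → p ≡ f ++ r × u ↭ f
  split-sorted p       []      w p↗        eq uw = [] , p , refl , ↭-refl
  split-sorted []      (y ∷ u) w p↗        eq uw = contradiction eq ¬x∷xs↭[]
  split-sorted (x ∷ p) (y ∷ u) w (x⊑ ∷ p↗) eq uw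
    with ∈-∃++ (x∈u (∈-++⁻ (y ∷ u) (∈-resp-↭ (↭-sym eq) (here refl))))
    where
    x∈u : x ∈ (y ∷ u) ⊎ x ∈ w → x ∈ y ∷ u
    x∈u (inj₁ x∈) = x∈
    x∈u (inj₂ x∈) with ∈-resp-↭ eq (here refl)
    ... | here refl = here refl
    ... | there y∈p = here (⊑-antisym (All.lookup x⊑ y∈p) (uw (here refl) x∈))
  ... | as , bs , u≡ =
    let u↭ = ↭-trans (↭-reflexive u≡) (shift x as bs)
        (f , r , p≡ , f↭) = split-sorted p (as ++ bs) w p↗
          (drop-∷ (↭-trans (↭-sym (Perm.++⁺ʳ w u↭)) eq))
          (λ y∈ → uw (∈-resp-↭ (↭-sym u↭) (there y∈)))
    in x ∷ f , r , cong (x ∷_) p≡ , ↭-trans u↭ (prep x f↭)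

  -- The entries of a block below `c`

  module _ (c : ℕ) (β α : List ℕ) where

    -- B is the whole current block, whose entries < c are u₀ and a prefix of the
    -- pending values p; a counts the entries of B that do not come from u₀.
    Row : List ℕ → List ℕ → ℕ → List ℕ × List (List ℕ) → Set
    Row p u₀ a (B , τ) = ∃ λ f → ∃ λ r → ∃ λ v →
      p ≡ f ++ r × B ≡ arrange (u₀ ++ f) ++ v × length f + length v ≡ a × Tail r c β α v τ

    RowStop : List ℕ → List ℕ → ℕ → List ℕ × List (List ℕ) → Set
    RowStop p u₀ a (B , τ) = ∃ λ v → B ≡ arrange u₀ ++ v × Block p c β α a (v , τ)

    enumerates-RowStop : ∀ p u₀ a {n} → Enumerates (Block p c β α a) n → Enumerates (RowStop p u₀ a) n
    enumerates-RowStop p u₀ a = enumerates-bij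
      (λ (v , τ) → arrange u₀ ++ v , τ) (λ (B , τ) → drop (length (arrange u₀)) B , τ)
      (λ (v , τ) t → v , refl , t)
      (λ { (_ , τ) (v , refl , t) → subst (λ v → Block p c β α a (v , τ)) (sym (drop-++ (arrange u₀) v)) t })
      (λ (v , τ) _ → cong (_, τ) (drop-++ (arrange u₀) v))
      (λ { (_ , τ) (v , refl , t) → cong (λ v → arrange u₀ ++ v , τ) (drop-++ (arrange u₀) v) })

    RowStop⇒Row : ∀ {p u₀ a} B×τ → RowStop p u₀ a B×τ → Row p u₀ a B×τ
    RowStop⇒Row {p} {u₀} _ (v , B≡ , len , t) =
      [] , p , v , refl , ≡.trans B≡ (cong (λ u → arrange u ++ v) (sym (++-identityʳ u₀))) , len , t

    Row-none : ∀ {p u₀ a} B τ r v → p ≡ r → B ≡ arrange (u₀ ++ []) ++ v → length v ≡ a →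
      Tail r c β α v τ → RowStop p u₀ a (B , τ)
    Row-none {u₀ = u₀} B τ r v refl B≡ len t =
      v , ≡.trans B≡ (cong (λ u → arrange u ++ v) (++-identityʳ u₀)) , len , t

    -- This is `walks-fusion` read on blocks: either the next pending value enters the block, which
    -- lowers `a` and `length p` by one, or no further one does, and the two sizes merge into
    -- `a + length p`.
    enumerates-Row : Counted α → ∀ p u₀ a → Inv p c → All (_< c) u₀ → a + sum α ≡ length p + sum β →
      Enumerates (Row p u₀ a) (walks (a ∷ length p ∷ β ++ α) 0)
    enumerates-Row ih p u₀ zero inv u₀<c eq = enumerates-⇔ RowStop⇒Row
      (λ { (B , τ) ([] , r , v , p≡ , B≡ , len , t) → Row-none B τ r v p≡ B≡ len t })
      (enumerates-RowStop p u₀ zero (enumerates-Block ih β zero inv eq))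
    enumerates-Row ih [] u₀ (suc a) inv u₀<c eq = enumerates-resize
      (cong (λ n → walks (β ++ α) (suc n)) (+-identityʳ a))
      (enumerates-⇔ RowStop⇒Row
        (λ { (B , τ) ([] , r , v , p≡ , B≡ , len , t) → Row-none B τ r v p≡ B≡ len t })
        (enumerates-RowStop [] u₀ (suc a) (enumerates-Block ih β (suc a) inv eq)))
    enumerates-Row ih (x ∷ p) u₀ (suc a) inv@(x<c ∷ p<c , x⊑ ∷ p↗) u₀<c eq = enumerates-resize
      (sym (walks-fusion a (length p) (β ++ α) 0))
      (enumerates-⊎ extend RowStop⇒Row case disjoint
        (enumerates-Row ih p (u₀ List.∷ʳ x) a (p<c , p↗) (All.++⁺ u₀<c (x<c ∷ [])) (suc-injective eq))
        (enumerates-RowStop (x ∷ p) u₀ (suc a) (enumerates-Block ih β (suc a) inv eq)))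
      where
      extend : ∀ B×τ → Row p (u₀ List.∷ʳ x) a B×τ → Row (x ∷ p) u₀ (suc a) B×τ
      extend _ (f , r , v , p≡ , B≡ , len , t) =
        x ∷ f , r , v , cong (x ∷_) p≡
        , ≡.trans B≡ (cong (λ u → arrange u ++ v) (++-assoc u₀ (x ∷ []) f)) , cong suc len , t
      case : ∀ B×τ → Row (x ∷ p) u₀ (suc a) B×τ → Row p (u₀ List.∷ʳ x) a B×τ ⊎ RowStop (x ∷ p) u₀ (suc a) B×τ
      case (B , τ) ([] , r , v , p≡ , B≡ , len , t) = inj₂ (Row-none B τ r v p≡ B≡ len t)
      case (B , τ) (y ∷ f , r , v , p≡ , B≡ , len , t) with ∷-injectiveˡ p≡
      ... | refl = inj₁ (f , r , v , ∷-injectiveʳ p≡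
        , ≡.trans B≡ (cong (λ u → arrange u ++ v) (sym (++-assoc u₀ (x ∷ []) f))) , suc-injective len , t)
      small : ∀ {u} → All (_< c) u → All (_< c) (arrange u)
      small {u} = All-resp-↭ (↭-sym (arrange-↭ u))
      -- The number of entries of the block below `c` tells how many pending values it took.
      disjoint : ∀ B×τ → Row p (u₀ List.∷ʳ x) a B×τ → ¬ RowStop (x ∷ p) u₀ (suc a) B×τ
      disjoint _ (f , r , v , refl , B≡ , len , t) (v′ , B≡′ , len′ , t′) =
        m≢1+m+n (length u₀) (≡.trans lengths more)
        where
        same : arrange u₀ ≡ arrange ((u₀ List.∷ʳ x) ++ f)
        same = cut-unique _ _ (small u₀<c) (Tail.above t′)
          (small (All.++⁺ (All.++⁺ u₀<c (x<c ∷ [])) (All.++⁻ˡ f p<c))) (Tail.above t)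
          (≡.trans (sym B≡′) B≡)
        lengths : length u₀ ≡ length ((u₀ List.∷ʳ x) ++ f)
        lengths = ≡.trans (sym (↭-length (arrange-↭ u₀))) (≡.trans (cong length same) (↭-length (arrange-↭ _)))
        more : length ((u₀ List.∷ʳ x) ++ f) ≡ suc (length u₀ + length f)
        more rewrite length-++ (u₀ List.∷ʳ x) {f} | length-++ u₀ {x ∷ []} | +-comm (length u₀) 1 = refl

    Row⇒Tail : ∀ {p a} B τ → Inv p c → Row p [] a (B , τ) → Tail p c β (a ∷ α) [] (B ∷ τ)
    Row⇒Tail {p} {a} B τ (p<c , p↗) (f , r , v , refl , refl , len , t) = record
      { incr = [] ; above = []
      ; perm = ↭-trans (↭-reflexive (++-assoc (arrange f) v (concat τ)))
          (↭-trans (Perm.++⁺ (arrange-↭ f) perm) (↭-reflexive (sym (++-assoc f r _))))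
      ; lens = cong₂ _∷_ (≡.trans (length-++ (arrange f)) (≡.trans (cong (_+ length v) (↭-length (arrange-↭ f))) len)) lens
      ; incrs = WeaklyIncr-glue small above (arrange-incr (AllPairs-++⁻ˡ f p↗)) incr ∷ incrs
      -- The later blocks are already ordered below `c`, so an entry smaller than `c` imposes
      -- nothing new.
      ; peaks = All.++⁺ (All.map (λ x<c → Ord-mono (<⇒≤ x<c) ord) small) ords , peaks
      ; ords = []
      -- Below `c`, the new block holds only values of `f` and the later blocks only values of `r`,
      -- and `f` precedes `r` in the sorted list `p`.
      ; ord = All.tabulate (λ C∈ y z y∈ z∈ y<c z<c → All.lookup (All.lookup (AllPairs-++⁻ˣ f p↗) (in-front y∈ y<c)) (in-rest (∈-concat⁺′ z∈ C∈) z<c)) ∷ ord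
      }
      where
      open Tail t
      small : All (_< c) (arrange f)
      small = All-resp-↭ (↭-sym (arrange-↭ f)) (All.++⁻ˡ f p<c)
      in-front : ∀ {y} → y ∈ arrange f ++ v → y < c → y ∈ f
      in-front y∈ y<c with ∈-++⁻ (arrange f) y∈
      ... | inj₁ y∈f = ∈-resp-↭ (arrange-↭ f) y∈f
      ... | inj₂ y∈v = contradiction (All.lookup above y∈v) (<⇒≱ y<c)
      in-rest : ∀ {z} → z ∈ concat τ → z < c → z ∈ r
      in-rest z∈ z<c with ∈-++⁻ r (∈-resp-↭ perm (∈-++⁺ʳ v z∈))
      ... | inj₁ z∈r = z∈r
      ... | inj₂ z∈m = contradiction (All.lookup (msetFrom-≥ c β) z∈m) (<⇒≱ z<c)

    -- The block is cut at `c`. By `Ord c` its lower part precedes in `⊑`-order all smaller values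
    -- of later blocks, so `split-sorted` makes it a prefix of `p`, and being weakly increasing it
    -- is the arranged prefix.
    Tail⇒Row : ∀ {p a} B τ → Inv p c → Tail p c β (a ∷ α) [] (B ∷ τ) → Row p [] a (B , τ)
    Tail⇒Row {p} {a} B τ (p<c , p↗) record { perm = perm ; lens = lens ; incrs = w ∷ ws ; peaks = ords , peaks ; ord = o ∷ ord }
      with cut c w
    ... | lo , hi , refl , lo<c , c≤hi , wlo , whi
      with split-sorted p lo (filter (_<? c) (concat τ)) p↗ filtered
             (λ y∈ z∈ → let (z∈′ , z<c) = ∈-filter⁻ (_<? c) {xs = concat τ} z∈
                            (C , z∈C , C∈) = ∈-concat⁻′ τ z∈′
                        in All.lookup o C∈ _ _ (∈-++⁺ˡ y∈) z∈C (All.lookup lo<c y∈) z<c)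
      where
      -- Among all values still to be placed, those below `c` are exactly the pending ones.
      filtered : lo ++ filter (_<? c) (concat τ) ↭ p
      filtered = subst₂ _↭_ lhs rhs (filter-↭ (_<? c) perm)
        where
        lhs : filter (_<? c) ((lo ++ hi) ++ concat τ) ≡ lo ++ filter (_<? c) (concat τ)
        lhs rewrite filter-++ (_<? c) (lo ++ hi) (concat τ) | filter-++ (_<? c) lo hi
                  | filter-all (_<? c) lo<c | filter-none (_<? c) (All.map ≤⇒≯ c≤hi) | ++-identityʳ lo = refl
        rhs : filter (_<? c) (p ++ msetFrom c β) ≡ p
        rhs rewrite filter-++ (_<? c) p (msetFrom c β) | filter-all (_<? c) p<c
                  | filter-none (_<? c) (All.map ≤⇒≯ (msetFrom-≥ c β)) = ++-identityʳ p
    ... | f , r , refl , lo↭f = f , r , hi , refl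
      , cong (_++ hi) (WeaklyIncr-↭⇒≡ wlo (arrange-incr (AllPairs-++⁻ˡ f p↗)) (↭-trans lo↭f (↭-sym (arrange-↭ f))))
      , ≡.trans (cong (_+ length hi) (sym (↭-length lo↭f))) (≡.trans (sym (length-++ lo)) (∷-injectiveˡ lens))
      , record
        { incr = whi ; above = c≤hi
        ; perm = drop-prefix f (↭-trans (Perm.++⁺ʳ _ (↭-sym lo↭f))
            (↭-trans (↭-reflexive (sym (++-assoc lo hi _))) (↭-trans perm (↭-reflexive (++-assoc f r _)))))
        ; lens = ∷-injectiveʳ lens ; incrs = ws ; peaks = peaks ; ords = All.++⁻ʳ lo ords ; ord = ord }

  counted : ∀ α → Counted α
  counted [] {[]} {c} β inv eq = enumerates-resize
    (sym (≡.trans (cong (λ μ → walks μ 0) (++-identityʳ β)) (walks-sum-zero β (sym eq))))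
    (enumerates-singleton []
      (record { incr = [] ; above = [] ; lens = refl ; incrs = [] ; peaks = tt ; ords = [] ; ord = []
              ; perm = ↭-reflexive (sym (length-zero (≡.trans (length-msetFrom c β) (sym eq)))) })
      λ { [] _ → refl ; (_ ∷ _) t → contradiction (Tail.lens t) λ () })
    where
    length-zero : ∀ {xs : List ℕ} → length xs ≡ 0 → xs ≡ []
    length-zero {[]} _ = refl
  counted (a ∷ α) {p} {c} β inv eq = enumerates-resize
    -- Reading a block puts its size `a` in front of the pending part, and the symmetry of the walk
    -- number moves it back to the head of `α`.
    (walks-↭ (↭-sym (shift a (length p ∷ β) α)) 0)
    (enumerates-bij (λ (B , τ) → B ∷ τ) uncons
      (λ (B , τ) → Row⇒Tail c β α B τ inv)
      (λ { [] t → contradiction (Tail.lens t) λ () ; (B ∷ τ) → Tail⇒Row c β α B τ inv })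
      (λ _ _ → refl)
      (λ { [] t → contradiction (Tail.lens t) λ () ; (B ∷ τ) _ → refl })
      (enumerates-Row c β α (counted α) p [] a inv [] eq))
    where
    uncons : List (List ℕ) → List ℕ × List (List ℕ)
    uncons []      = [] , []
    uncons (B ∷ τ) = B , τ

  enumerates-NoPeak : ∀ α β → sum α ≡ sum β →
    Enumerates (λ τ → GenPerm α β τ × NoPeak τ) (walks (α ++ β) 0)
  enumerates-NoPeak α β eq = enumerates-resize (walks-↭ (Perm.++-comm β α) 0)
    (enumerates-⇔
      (λ τ t → let open Tail t in (lens , incrs , perm) , peaks)
      (λ τ ((lens , incrs , perm) , peaks) → record
        { incr = [] ; above = [] ; perm = perm ; lens = lens ; incrs = incrs ; peaks = peaks ; ords = []
        ; ord = trivial τ (All-resp-↭ (↭-sym perm) (msetFrom-≥ 1 β)) })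
      -- At the start nothing is pending, which counts as a part 0, and all entries are at least 1,
      -- so `Ord 1` holds vacuously.
      (counted α {[]} {1} β ([] , []) eq))
    where
    trivial : ∀ τ → All (1 ≤_) (concat τ) → Ord 1 τ
    trivial []      _  = []
    trivial (B ∷ τ) ps = All.tabulate (λ _ y z y∈ _ y<1 _ → contradiction (All.lookup (All.++⁻ˡ B ps) y∈) (<⇒≱ y<1))
      ∷ trivial τ (All.++⁻ʳ B ps)

  -- Peaks and occurrences of a pattern

  NoPeak⇒¬Occurs : ∀ {Q τ} → (∀ {x y z} → Q x y z → y < x × z < x × ¬ y ⊑ z) → NoPeak τ → ¬ Occurs Q τ
  NoPeak⇒¬Occurs q (_ , peaks) (B₁ , B₂ , B₃ , _ ∷ʳ s , occ) = NoPeak⇒¬Occurs q peaks (B₁ , B₂ , B₃ , s , occ)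
  NoPeak⇒¬Occurs q (ords , _) (B₁ , B₂ , B₃ , refl ∷ s , x , y , z , x∈ , y∈ , z∈ , qxyz)
    with AllPairs-resp-⊆ s (All.lookup ords x∈) | q qxyz
  ... | (o ∷ _) ∷ _ | y<x , z<x , y⋢z = y⋢z (o y z y∈ z∈ y<x z<x)

  ¬Occurs⇒NoPeak : ∀ {Q} τ → (∀ {x y z} → y < x → z < x → ¬ y ⊑ z → Q x y z) → ¬ Occurs Q τ → NoPeak τ
  ¬Occurs⇒NoPeak []      q ¬occ = tt
  ¬Occurs⇒NoPeak (B ∷ τ) q ¬occ =
    All.tabulate (λ {x} x∈ → AllPairs-from-⊆ τ λ s y z y∈ z∈ y<x z<x → decidable-stable (y ⊑? z) λ y⋢z →
      ¬occ (_ , _ , _ , refl ∷ s , x , y , z , x∈ , y∈ , z∈ , q y<x z<x y⋢z))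
    , ¬Occurs⇒NoPeak τ q λ (B₁ , B₂ , B₃ , s , occ) → ¬occ (B₁ , B₂ , B₃ , B ∷ʳ s , occ)

Counts : (ℕ → ℕ → ℕ → Set) → Set
Counts Q = ∀ α β → sum α ≡ sum β → Enumerates (λ τ → GenPerm α β τ × ¬ Occurs Q τ) (walks (α ++ β) 0)

-- The pending values form a queue when avoiding 321 and a stack when avoiding 312.
module Queue = Pending _≤_ _≤?_ ≤-antisym id (λ _ → ↭-refl) AllPairs⇒Linked _++_ (λ _ _ → ↭-refl)
  (λ b p<c p↗ → AllPairs.++⁺ p↗ (AllPairs-replicate b ≤-refl) (All.map (λ x<c → All.replicate⁺ b (<⇒≤ x<c)) p<c))

module Stack = Pending _≥_ _≥?_ (λ x≥y y≥x → ≤-antisym y≥x x≥y) reverse ↭-reverse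
  (λ p↘ → AllPairs⇒Linked (AllPairs-reverse p↘)) (λ p q → q ++ p) (λ p q → Perm.++-comm q p)
  (λ b p<c p↘ → AllPairs.++⁺ (AllPairs-replicate b ≤-refl) p↘ (All.replicate⁺ b (All.map <⇒≤ p<c)))

-- i, j and k are the positions of the smallest, middle and largest entry.
pattern-at : Fin 3 → Fin 3 → Fin 3 → ℕ → ℕ → ℕ → Set
pattern-at i j k x y z = v i < v j × v j < v k where v = vlookup (x ∷ y ∷ z ∷ [])

counts-321 : Counts (pattern-at 2F 1F 0F)
counts-321 α β eq = enumerates-⇔
  (λ τ (g , n) → g , Queue.NoPeak⇒¬Occurs (λ (z<y , y<x) → y<x , <-trans z<y y<x , <⇒≱ z<y) n)
  (λ τ (g , n) → g , Queue.¬Occurs⇒NoPeak τ (λ y<x z<x y≰z → ≰⇒> y≰z , y<x) n)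
  (Queue.enumerates-NoPeak α β eq)

counts-312 : Counts (pattern-at 1F 2F 0F)
counts-312 α β eq = enumerates-⇔
  (λ τ (g , n) → g , Stack.NoPeak⇒¬Occurs (λ (y<z , z<x) → <-trans y<z z<x , z<x , <⇒≱ y<z) n)
  (λ τ (g , n) → g , Stack.¬Occurs⇒NoPeak τ (λ y<x z<x y≱z → ≰⇒> y≱z , z<x) n)
  (Stack.enumerates-NoPeak α β eq)

-- Symmetries

concat-↭ : ∀ {τ σ : List (List ℕ)} → τ ↭ σ → concat τ ↭ concat σ
concat-↭ refl         = refl
concat-↭ (prep B p)   = Perm.++⁺ˡ B (concat-↭ p)
concat-↭ (swap B C p) = ↭-trans (Perm.shifts B C) (Perm.++⁺ˡ C (Perm.++⁺ˡ B (concat-↭ p)))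
concat-↭ (trans p q)  = trans (concat-↭ p) (concat-↭ q)

GenPerm-reverse : ∀ {α} β τ → GenPerm α β τ → GenPerm (reverse α) β (reverse τ)
GenPerm-reverse β τ (lens , incrs , perm) =
  ≡.trans (reverse-map length τ) (cong reverse lens)
  , All-resp-↭ (↭-sym (↭-reverse τ)) incrs
  , ↭-trans (concat-↭ (↭-reverse τ)) perm

Occurs-reverse : ∀ {Q : ℕ → ℕ → ℕ → Set} {τ} → Occurs Q τ → Occurs (λ x y z → Q z y x) (reverse τ)
Occurs-reverse (B₁ , B₂ , B₃ , s , x , y , z , x∈ , y∈ , z∈ , q) =
  B₃ , B₂ , B₁ , reverse⁺ s , z , y , x , z∈ , y∈ , x∈ , q

-- Reversing the order of the blocks reverses the pattern and replaces `α` by `reverse α`, which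
-- leaves the walk number unchanged.
counts-reverse : ∀ {Q} → Counts Q → Counts (λ x y z → Q z y x)
counts-reverse {Q} count α β eq = enumerates-resize (walks-↭ (Perm.++⁺ʳ β (↭-reverse α)) 0)
  (enumerates-bij reverse reverse
    (λ τ (g , n) → subst (λ α → GenPerm α β (reverse τ)) (reverse-involutive α) (GenPerm-reverse β τ g)
      , λ occ → n (subst (Occurs Q) (reverse-involutive τ) (Occurs-reverse occ)))
    (λ τ (g , n) → GenPerm-reverse β τ g
      , λ occ → n (subst (Occurs _) (reverse-involutive τ) (Occurs-reverse occ)))
    (λ τ _ → reverse-involutive τ) (λ τ _ → reverse-involutive τ)
    (count (reverse α) β (≡.trans (sum-↭ (↭-reverse α)) eq)))

-- Complementing the values 1, ..., m turns a block around, and `reverse` makes it weakly increasing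
-- again.
flip : ℕ → List ℕ → List ℕ
flip m B = reverse (map (suc m ∸_) B)

msetFrom-snoc : ∀ k β b → msetFrom k (β List.∷ʳ b) ≡ msetFrom k β ++ replicate b (k + length β)
msetFrom-snoc k []      b rewrite +-identityʳ k = ++-identityʳ (replicate b k)
msetFrom-snoc k (a ∷ β) b rewrite msetFrom-snoc (suc k) β b | +-suc k (length β) =
  sym (++-assoc (replicate a k) _ _)

-- The condition on `n` says that the last value, k + length β - 1, is sent to `k′`, so the
-- multiplicities are read backwards starting at `k′`.
msetFrom-complement : ∀ n k k′ β → suc n ≡ k + k′ + length β →
  map (n ∸_) (msetFrom k β) ↭ msetFrom k′ (reverse β)
msetFrom-complement n k k′ []      eq = refl
msetFrom-complement n k k′ (b ∷ β) eq with suc-injective (≡.trans eq (+-suc (k + k′) (length β)))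
... | refl
  rewrite map-++ (n ∸_) (replicate b k) (msetFrom (suc k) β) | map-replicate (n ∸_) b k
        | unfold-reverse b β | msetFrom-snoc k′ (reverse β) b | length-reverse β
        | +-assoc k k′ (length β) | m+n∸m≡n k (k′ + length β)
  = ↭-trans (Perm.++⁺ˡ (replicate b _)
        (msetFrom-complement (k + (k′ + length β)) (suc k) k′ β (cong suc (sym (+-assoc k k′ (length β))))))
      (Perm.++-comm (replicate b _) _)

msetFrom-< : ∀ k β → All (_< k + length β) (msetFrom k β)
msetFrom-< k []      = []
msetFrom-< k (b ∷ β) rewrite +-suc k (length β) = All.++⁺ (All.replicate⁺ b (s≤s (m≤m+n k _))) (msetFrom-< (suc k) β)

GenPerm-bound : ∀ {α} β τ → GenPerm α β τ → All (_≤ length β) (concat τ)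
GenPerm-bound β τ (_ , _ , perm) = All-resp-↭ (↭-sym perm) (All.map ≤-pred (msetFrom-< 1 β))

GenPerm-flip : ∀ {α} β τ → GenPerm α β τ → GenPerm α (reverse β) (map (flip (length β)) τ)
GenPerm-flip β τ (lens , incrs , perm) =
  ≡.trans (sym (map-∘ τ)) (≡.trans (map-cong (λ B → ≡.trans (length-reverse (map _ B)) (length-map _ B)) τ) lens)
  , All.map⁺ (All.map flip-incr incrs)
  , ↭-trans (concat-flip τ) (↭-trans (Perm.map⁺ _ perm) (msetFrom-complement (suc (length β)) 1 1 β refl))
  where
  flip-incr : ∀ {B} → WeaklyIncr B → WeaklyIncr (flip (length β) B)
  flip-incr w = AllPairs⇒Linked (AllPairs-reverse
    (AllPairs.map⁺ (AllPairs.map (∸-monoʳ-≤ (suc (length β))) (WeaklyIncr⇒AllPairs w))))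
  concat-flip : ∀ τ → concat (map (flip (length β)) τ) ↭ map (suc (length β) ∸_) (concat τ)
  concat-flip []      = refl
  concat-flip (B ∷ τ) rewrite map-++ (suc (length β) ∸_) B (concat τ) =
    Perm.++⁺ (↭-reverse (map _ B)) (concat-flip τ)

flip-involutive : ∀ m B → All (_≤ m) B → flip m (flip m B) ≡ B
flip-involutive m B B≤ = ≡.trans (cong reverse (reverse-map (suc m ∸_) (map (suc m ∸_) B)))
  (≡.trans (reverse-involutive _)
  (≡.trans (sym (map-∘ B)) (map-id-local (All.map (λ x≤m → m∸[m∸n]≡n (m≤n⇒m≤1+n x≤m)) B≤))))

map-flip-involutive : ∀ m τ → All (_≤ m) (concat τ) → map (flip m) (map (flip m) τ) ≡ τ
map-flip-involutive m []      _  = refl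
map-flip-involutive m (B ∷ τ) τ≤ =
  cong₂ _∷_ (flip-involutive m B (All.++⁻ˡ B τ≤)) (map-flip-involutive m τ (All.++⁻ʳ B τ≤))

-- The bounds by `m` are what makes truncated subtraction strictly order reversing.
Complementary : (Q Q′ : ℕ → ℕ → ℕ → Set) → Set
Complementary Q Q′ = ∀ {m x y z} → x ≤ m → y ≤ m → z ≤ m → Q x y z → Q′ (m ∸ x) (m ∸ y) (m ∸ z)

Occurs-flip : ∀ {Q Q′ m τ} → Complementary Q Q′ → All (_≤ m) (concat τ) → Occurs Q τ → Occurs Q′ (map (flip m) τ)
Occurs-flip {m = m} {τ} c τ≤ (B₁ , B₂ , B₃ , s , x , y , z , x∈ , y∈ , z∈ , q) =
  _ , _ , _ , map⁺ (flip m) s , _ , _ , _ , move x∈ , move y∈ , move z∈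
  , c (bound x∈ (here refl)) (bound y∈ (there (here refl))) (bound z∈ (there (there (here refl)))) q
  where
  move : ∀ {x B} → x ∈ B → suc m ∸ x ∈ flip m B
  move x∈ = ∈-resp-↭ (↭-sym (↭-reverse _)) (∈-map⁺ (suc m ∸_) x∈)
  bound : ∀ {x B} → x ∈ B → B ∈ B₁ ∷ B₂ ∷ B₃ ∷ [] → x ≤ suc m
  bound x∈ B∈ = m≤n⇒m≤1+n (All.lookup τ≤ (∈-concat⁺′ x∈ (Sublist.lookup s B∈)))

counts-complement : ∀ {Q Q′} → Complementary Q Q′ → Complementary Q′ Q → Counts Q → Counts Q′
counts-complement {Q} {Q′} c c′ count α β eq = enumerates-resize (walks-↭ (Perm.++⁺ˡ α (↭-reverse β)) 0)
  (enumerates-bij (map (flip m)) (map (flip m))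
    (λ τ (g , n) → forth τ g , λ occ → n (subst (Occurs Q) (map-flip-involutive m τ (bound τ g))
      (Occurs-flip c′ (GenPerm-bound β _ (forth τ g)) occ)))
    (λ τ (g , n) → GenPerm-flip β τ g , λ occ → n (subst (Occurs Q′) (map-flip-involutive m τ (GenPerm-bound β τ g))
      (Occurs-flip c (bound _ (GenPerm-flip β τ g)) occ)))
    (λ τ (g , _) → map-flip-involutive m τ (bound τ g))
    (λ τ (g , _) → map-flip-involutive m τ (GenPerm-bound β τ g))
    (count α (reverse β) (≡.trans eq (sym (sum-↭ (↭-reverse β))))))
  where
  m = length β
  bound : ∀ τ → GenPerm α (reverse β) τ → All (_≤ m) (concat τ)
  bound τ g = subst (λ m → All (_≤ m) (concat τ)) (length-reverse β) (GenPerm-bound (reverse β) τ g)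
  forth : ∀ τ → GenPerm α (reverse β) τ → GenPerm α β (map (flip m) τ)
  forth τ g = subst₂ (λ m β → GenPerm α β (map (flip m) τ)) (length-reverse β) (reverse-involutive β) (GenPerm-flip (reverse β) τ g)

counts-132 : Counts (pattern-at 0F 2F 1F)
counts-132 = counts-complement
  (λ x≤ y≤ z≤ (y<z , z<x) → ∸-monoʳ-< z<x x≤ , ∸-monoʳ-< y<z z≤)
  (λ x≤ y≤ z≤ (x<z , z<y) → ∸-monoʳ-< z<y y≤ , ∸-monoʳ-< x<z z≤)
  counts-312

-- Reversal takes 321, 312 and 132 to 123, 213 and 231, which completes the six patterns.
counts : ∀ i j k → i ≢ j → i ≢ k → j ≢ k → Counts (pattern-at i j k)
counts 0F 1F 2F _ _ _ = counts-reverse counts-321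
counts 0F 2F 1F _ _ _ = counts-132
counts 1F 0F 2F _ _ _ = counts-reverse counts-312
counts 1F 2F 0F _ _ _ = counts-312
counts 2F 0F 1F _ _ _ = counts-reverse counts-132
counts 2F 1F 0F _ _ _ = counts-321
counts 0F 0F _ i≢j _ _ = contradiction refl i≢j
counts 1F 1F _ i≢j _ _ = contradiction refl i≢j
counts 2F 2F _ i≢j _ _ = contradiction refl i≢j
counts 0F _ 0F _ i≢k _ = contradiction refl i≢k
counts 1F _ 1F _ i≢k _ = contradiction refl i≢k
counts 2F _ 2F _ i≢k _ = contradiction refl i≢k
counts _ 0F 0F _ _ j≢k = contradiction refl j≢k
counts _ 1F 1F _ _ j≢k = contradiction refl j≢k
counts _ 2F 2F _ _ j≢k = contradiction refl j≢k

-- Patterns given by permutations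

module _ (π : Permutation′ 3) where

  -- The inverse of `π` gives the positions of its values in increasing order, and an order
  -- isomorphism amounts to strict increase along these positions.
  Matches : ℕ → ℕ → ℕ → Set
  Matches = pattern-at (π ⟨$⟩ˡ 0F) (π ⟨$⟩ˡ 1F) (π ⟨$⟩ˡ 2F)

  OrderIso⇒Matches : ∀ {x y z} → OrderIso (x ∷ y ∷ z ∷ []) π → Matches x y z
  OrderIso⇒Matches iso = rises 0F 1F (s≤s z≤n) , rises 1F 2F (s≤s (s≤s z≤n))
    where
    rises : ∀ i j → i F.< j → vlookup (_ ∷ _ ∷ _ ∷ []) (π ⟨$⟩ˡ i) < vlookup (_ ∷ _ ∷ _ ∷ []) (π ⟨$⟩ˡ j)
    rises i j i<j = Equivalence.from (iso _ _) (subst₂ F._<_ (sym (inverseʳ π)) (sym (inverseʳ π)) i<j)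

  Matches⇒OrderIso : ∀ {x y z} → Matches x y z → OrderIso (x ∷ y ∷ z ∷ []) π
  Matches⇒OrderIso {x} {y} {z} (p , q) s t = mk⇔ reflects preserves
    where
    v = vlookup (x ∷ y ∷ z ∷ [])
    chain : ∀ i j → i F.< j → v (π ⟨$⟩ˡ i) < v (π ⟨$⟩ˡ j)
    chain 0F 1F _ = p
    chain 0F 2F _ = <-trans p q
    chain 1F 2F _ = q
    chain 1F 1F (s≤s ())
    chain 2F 1F (s≤s ())
    chain 2F 2F (s≤s (s≤s ()))
    preserves : ∀ {s t} → (π ⟨$⟩ʳ s) F.< (π ⟨$⟩ʳ t) → v s < v t
    preserves {s} {t} lt = subst₂ (λ s t → v s < v t) (inverseˡ π) (inverseˡ π) (chain (π ⟨$⟩ʳ s) (π ⟨$⟩ʳ t) lt)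
    reflects : v s < v t → (π ⟨$⟩ʳ s) F.< (π ⟨$⟩ʳ t)
    reflects vs<vt with F.<-cmp (π ⟨$⟩ʳ s) (π ⟨$⟩ʳ t)
    ... | tri< lt _ _ = lt
    ... | tri> _ _ gt = contradiction (preserves gt) (<⇒≯ vs<vt)
    ... | tri≈ _ eq _ = contradiction (cong v (≡.trans (sym (inverseˡ π)) (≡.trans (cong (π ⟨$⟩ˡ_) eq) (inverseˡ π)))) (<⇒≢ vs<vt)

-- Indices and sublists of blocks

lookup-⊆₁ : ∀ {A : Set} (τ : List A) i → lookup τ i ∷ [] ⊆ τ
lookup-⊆₁ (B ∷ τ) zero    = refl ∷ Sublist.minimum τ
lookup-⊆₁ (B ∷ τ) (suc i) = B ∷ʳ lookup-⊆₁ τ i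

lookup-⊆₂ : ∀ {A : Set} (τ : List A) i j → i F.< j → lookup τ i ∷ lookup τ j ∷ [] ⊆ τ
lookup-⊆₂ (B ∷ τ) zero    (suc j) _         = refl ∷ lookup-⊆₁ τ j
lookup-⊆₂ (B ∷ τ) (suc i) (suc j) (s≤s i<j) = B ∷ʳ lookup-⊆₂ τ i j i<j

lookup-⊆₃ : ∀ {A : Set} (τ : List A) i j k → i F.< j → j F.< k → lookup τ i ∷ lookup τ j ∷ lookup τ k ∷ [] ⊆ τ
lookup-⊆₃ (B ∷ τ) zero    (suc j) (suc k) _         (s≤s j<k) = refl ∷ lookup-⊆₂ τ j k j<k
lookup-⊆₃ (B ∷ τ) (suc i) (suc j) (suc k) (s≤s i<j) (s≤s j<k) = B ∷ʳ lookup-⊆₃ τ i j k i<j j<k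

⊆-lookup₁ : ∀ {A : Set} {B : A} {τ} → B ∷ [] ⊆ τ → ∃ λ i → lookup τ i ≡ B
⊆-lookup₁ (_ ∷ʳ s)   = let (i , eq) = ⊆-lookup₁ s in suc i , eq
⊆-lookup₁ (refl ∷ _) = zero , refl

⊆-lookup₂ : ∀ {A : Set} {B C : A} {τ} → B ∷ C ∷ [] ⊆ τ →
  ∃ λ i → ∃ λ j → i F.< j × lookup τ i ≡ B × lookup τ j ≡ C
⊆-lookup₂ (_ ∷ʳ s)   = let (i , j , i<j , eqs) = ⊆-lookup₂ s in suc i , suc j , s≤s i<j , eqs
⊆-lookup₂ (refl ∷ s) = let (j , eq) = ⊆-lookup₁ s in zero , suc j , s≤s z≤n , refl , eq

⊆-lookup₃ : ∀ {A : Set} {B C D : A} {τ} → B ∷ C ∷ D ∷ [] ⊆ τ →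
  ∃ λ i → ∃ λ j → ∃ λ k → i F.< j × j F.< k × lookup τ i ≡ B × lookup τ j ≡ C × lookup τ k ≡ D
⊆-lookup₃ (_ ∷ʳ s)   =
  let (i , j , k , i<j , j<k , eqs) = ⊆-lookup₃ s in suc i , suc j , suc k , s≤s i<j , s≤s j<k , eqs
⊆-lookup₃ (refl ∷ s) =
  let (j , k , j<k , eqs) = ⊆-lookup₂ s in zero , suc j , suc k , s≤s z≤n , s≤s j<k , refl , eqs

Contains⇒Occurs : ∀ π {τ} → Contains π τ → Occurs (Matches π) τ
Contains⇒Occurs π {τ} (i , j , k , i<j , j<k , x , y , z , x∈ , y∈ , z∈ , iso) =
  _ , _ , _ , lookup-⊆₃ τ i j k i<j j<k , x , y , z , x∈ , y∈ , z∈ , OrderIso⇒Matches π iso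

Occurs⇒Contains : ∀ π {τ} → Occurs (Matches π) τ → Contains π τ
Occurs⇒Contains π (B , C , D , s , x , y , z , x∈ , y∈ , z∈ , m) with ⊆-lookup₃ s
... | i , j , k , i<j , j<k , refl , refl , refl =
  i , j , k , i<j , j<k , x , y , z , x∈ , y∈ , z∈ , Matches⇒OrderIso π m

enumerates-SAvoid : ∀ π α β → sum α ≡ sum β → Enumerates (SAvoid α β π) (walks (α ++ β) 0)
enumerates-SAvoid π α β eq = enumerates-⇔
  (λ τ (g , n) → g , n ∘ Contains⇒Occurs π) (λ τ (g , n) → g , n ∘ Occurs⇒Contains π)
  (counts (π ⟨$⟩ˡ 0F) (π ⟨$⟩ˡ 1F) (π ⟨$⟩ˡ 2F) (distinct λ ()) (distinct λ ()) (distinct λ ()) α β eq)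
  where
  distinct : ∀ {i j} → i ≢ j → π ⟨$⟩ˡ i ≢ π ⟨$⟩ˡ j
  distinct i≢j eq = i≢j (≡.trans (sym (inverseʳ π)) (≡.trans (cong (π ⟨$⟩ʳ_) eq) (inverseʳ π)))

theorem1p4 :
  (α β : List ℕ) → sum α ≡ sum β → (π : Permutation′ 3) →
  -- |S_{αβ}(π)| = |S_{βα}(π)| = K_{(N,N),(α,β)}
  (∃ λ K → Kostka (twoRow (sum α)) (α ++ β) K
         × Enumerates (SAvoid α β π) K
         × Enumerates (SAvoid β α π) K)
  -- independence of the order of the entries of α and of β
  × ((α′ β′ : List ℕ) → α′ ↭ α → β′ ↭ β → (a b : ℕ) →
     Enumerates (SAvoid α β π) a → Enumerates (SAvoid α′ β′ π) b → a ≡ b)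
  -- Schur-concavity in α
  × ((α′ : List ℕ) → IsPartition α → IsPartition α′ → IsPartition β →
     sum α′ ≡ sum α → Dominates α α′ → (a b : ℕ) →
     Enumerates (SAvoid α β π) a → Enumerates (SAvoid α′ β π) b → a ≤ b)
  -- Schur-concavity in β
  × ((β′ : List ℕ) → IsPartition α → IsPartition β → IsPartition β′ →
     sum β′ ≡ sum β → Dominates β β′ → (a b : ℕ) →
     Enumerates (SAvoid α β π) a → Enumerates (SAvoid α β′ π) b → a ≤ b)
theorem1p4 α β eq π =
  ( walks (α ++ β) 0
  , kostka-twoRow (α ++ β) (sum α) (≡.trans (sum-++ α β) (cong (sum α +_) (sym eq)))
  , enumerates-SAvoid π α β eq
  , enumerates-resize (walks-↭ (Perm.++-comm β α) 0) (enumerates-SAvoid π β α (sym eq)))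
  , (λ α′ β′ α′↭ β′↭ a b e e′ → ≡.trans (size α β eq e)
      (≡.trans (walks-↭ (↭-sym (Perm.++⁺ α′↭ β′↭)) 0)
        (sym (size α′ β′ (≡.trans (sum-↭ α′↭) (≡.trans eq (sym (sum-↭ β′↭)))) e′))))
  , (λ α′ _ (α′↘ , _) _ eq′ dom a b e e′ →
      subst₂ _≤_ (sym (size α β eq e)) (sym (size α′ β (≡.trans eq′ eq) e′))
        (walks-dominance α α′ β 0 (Linked⇒AllPairs ≥-trans α′↘) (sym eq′) dom))
  -- Symmetry of the walk number brings `β` and `β′` to the front, where `walks-dominance` compares
  -- them.
  , (λ β′ _ _ (β′↘ , _) eq′ dom a b e e′ →
      subst₂ _≤_
        (≡.trans (walks-↭ (Perm.++-comm β α) 0) (sym (size α β eq e)))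
        (≡.trans (walks-↭ (Perm.++-comm β′ α) 0) (sym (size α β′ (≡.trans eq (sym eq′)) e′)))
        (walks-dominance β β′ α 0 (Linked⇒AllPairs ≥-trans β′↘) (sym eq′) dom))
  where
  ≥-trans : ∀ {i j k} → i ≥ j → j ≥ k → i ≥ k
  ≥-trans p q = ≤-trans q p
  size : ∀ α β → sum α ≡ sum β → ∀ {n} → Enumerates (SAvoid α β π) n → n ≡ walks (α ++ β) 0
  size α β eq e = enumerates-unique e (enumerates-SAvoid π α β eq)
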